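{- Let $\lambda$ be any uncountable cardinal and let $G_\alpha$ ($\alpha\in\lambda$) be non-trivial groups. Let $\mathcal{G}$ denote the complete free product of the groups $G_\alpha$ ($\alpha\in\lambda$). For each regular uncountable cardinal $\kappa\le\lambda$ there exists a group homomorphism $\varphi_\kappa:\mathcal{G}\to\mathbb{Z}$ for which the (non-commutative) Specker Phenomenon fails; that is, there do not exist a finite subset $F\subseteq\lambda$ and a homomorphism $\bar h: *_{\alpha\in F}G_\alpha\to\mathbb{Z}$ with $\varphi_\kappa=\bar h\circ\rho_F$, where $\rho_F:\mathcal{G}\to *_{\alpha\in F}G_\alpha$ is the natural map.
   Context: Let $I$ be an index set and let $G_i$ ($i\in I$) be non-trivial groups, taken so that $G_i\cap G_j=\{e\}$ for $i\ne j$. Elements of $\bigcup_{i\in I}G_i$ are called letters. A word is a function $W:\overline{W}\to\bigcup_{i\in I}G_i$ such that $\overline{W}$ is a linearly ordered set (of arbitrary order type and cardinality) and $W^{ -1}(G_i)$ is finite for every $i\in I$. Words $U,V$ are isomorphic if there is an order isomorphism $\varphi:\overline{U}\to\overline{V}$ with $U(\alpha)=V(\varphi(\alpha))$ for all $\alpha\in\overline{U}$; words are considered up to isomorphism, so that they form a set. For $X\subseteq I$, the restricted word $W_X$ is the restriction of $W$ to $\overline{W_X}=\{\alpha\in\overline{W}: W(\alpha)\in\bigcup_{i\in X}G_i\}$. For finite $F\subseteq I$, $W_F$ is a finite word and is regarded as an element of the free product $*_{i\in F}G_i$. Two words $U,V$ are equivalent, $U\sim V$, if $U_F=V_F$ in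 $*_{i\in F}G_i$ for all finite $F\subseteq I$; $[W]$ denotes the equivalence class of $W$. The product of two words is their concatenation, and the inverse of a word is obtained by reversing the order and inverting each letter. These operations induce a group structure on the set of equivalence classes. The resulting group is the complete free product of the $G_i$ ($i\in I$). For finite $F\subseteq I$, the natural map $\rho_F$ from the complete free product to $*_{i\in F}G_i$ is $[W]\mapsto W_F$. The group $\mathbb{Z}$ is the additive group of integers. -}

module Defs where

open import Algebra.Bundles using (AbelianGroup; Group)
open import Algebra.Morphism.Structures using (IsGroupHomomorphism)
import Algebra.Properties.Group as GroupProperties
open import Data.Integer.Base using (ℤ)
open import Data.Integer.Properties using (+-0-abelianGroup)
open import Data.List.Base using (List; []; _∷_; [_]; _++_; map; reverse; deduplicate)
import Data.List.Membership.Setoid as SetoidMembership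
open import Data.List.Membership.Propositional using (_∈_)
open import Data.List.Properties
  using (++-assoc; ++-identityʳ; map-++; map-∘; reverse-++; reverse-map)
open import Data.List.Relation.Binary.Pointwise using (Pointwise; []; _∷_)
import Data.List.Relation.Binary.Permutation.Setoid as SetoidPermutation
import Data.List.Relation.Binary.Permutation.Setoid.Properties as SetoidPermutationProperties
import Data.List.Sort as Sort
open import Data.List.Relation.Unary.All as All using (All; []; _∷_)
import Data.List.Relation.Unary.All.Properties as All
open import Data.List.Relation.Unary.AllPairs as AllPairs using (AllPairs; []; _∷_)
import Data.List.Relation.Unary.AllPairs.Properties as AllPairs
open import Data.List.Relation.Unary.Any using (here; there)
import Data.List.Relation.Unary.Any as Any
import Data.List.Relation.Unary.Any.Properties as Any
open import Data.List.Relation.Unary.Enumerates.Setoid using (IsEnumeration)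
import Data.List.Relation.Unary.Enumerates.Setoid.Properties as Enumeration
open import Data.List.Relation.Unary.Linked.Properties using (Linked⇒AllPairs)
import Data.List.Relation.Unary.Unique.DecSetoid.Properties as Unique
open import Data.Nat.Base using (ℕ)
open import Data.Product.Base using (Σ; Σ-syntax; ∃-syntax; _×_; _,_; proj₁; proj₂; map₂)
open import Data.Sum.Base using (inj₁; inj₂; [_,_]′)
open import Data.Sum.Relation.Binary.LeftOrder using (⊎-<-isStrictTotalOrder; ₁∼₁; ₁∼₂; ₂∼₂)
open import Data.Sum.Relation.Binary.Pointwise using (inj₁; inj₂)
open import Function.Base using (flip)
open import Function.Bundles using (_↣_; Func)
open import Function.Definitions using (Injective)
open import Induction.WellFounded using (WellFounded)
open import Level using (Level; _⊔_; suc; Lift)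
open import Relation.Binary.Bundles using (Setoid; StrictTotalOrder)
import Relation.Binary.Construct.Flip.EqAndOrd as Flip
import Relation.Binary.Construct.On as On
open import Relation.Binary.Core using (Rel; REL)
import Relation.Binary.Properties.StrictTotalOrder as StrictTotalOrderProperties
open import Relation.Binary.PropositionalEquality.Core as ≡ using (_≡_)
open import Relation.Binary.Structures using (IsStrictTotalOrder)
open import Relation.Nullary.Negation.Core using (¬_; contradiction)
open import Relation.Unary using (Pred)

private
  variable
    ℓ : Level

------------------------------------------------------------------------
-- Choice

-- The function chosen is extensional.  Without that requirement the
-- principle is provable, since an existential carries its witness.
AxiomOfChoice : ∀ a₁ a₂ b₁ b₂ r → Set (suc (a₁ ⊔ a₂ ⊔ b₁ ⊔ b₂ ⊔ r))
AxiomOfChoice a₁ a₂ b₁ b₂ r =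
  (A : Setoid a₁ a₂) (B : Setoid b₁ b₂) →
  let module A = Setoid A ; module B = Setoid B in
  (R : REL A.Carrier B.Carrier r) →
  (∀ {x x′ y y′} → x A.≈ x′ → y B.≈ y′ → R x y → R x′ y′) →
  (∀ x → ∃[ y ] R x y) →
  ∃[ f ] (∀ x → R x (Func.to {From = A} {To = B} f x))

------------------------------------------------------------------------
-- Cardinals

-- Cardinals are initial ordinals: well-ordered sets that do not inject
-- into any of their proper initial segments.
record Cardinal ℓ : Set (suc ℓ) where
  infix 4 _<_
  field
    Carrier            : Set ℓ
    _<_                : Rel Carrier ℓ
    isStrictTotalOrder : IsStrictTotalOrder _≡_ _<_
    wellFounded        : WellFounded _<_
    initial            : ∀ a (f : Carrier → Carrier) → Injective _≡_ _≡_ f →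
                         ¬ (∀ x → f x < a)

infix 4 _≤ᶜ_

_≤ᶜ_ : Rel (Cardinal ℓ) ℓ
κ ≤ᶜ μ = Cardinal.Carrier κ ↣ Cardinal.Carrier μ

Uncountable : Pred (Cardinal ℓ) ℓ
Uncountable κ = ¬ (Cardinal.Carrier κ ↣ ℕ)

-- No function from a smaller ordinal is cofinal.  Only the values of f
-- below a matter.  This is regularity for infinite cardinals.
Regular : Pred (Cardinal ℓ) ℓ
Regular κ = ∀ a (f : Carrier → Carrier) → ∃[ b ] (∀ x → x < a → f x < b)
  where open Cardinal κ

NonTrivial : Pred (Group ℓ ℓ) ℓ
NonTrivial G = ∃[ x ] ¬ (x ≈ ε)
  where open Group G

------------------------------------------------------------------------
-- Free products

-- The free product of the groups G i with i in X: lists of elements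
-- of these groups, modulo the congruence generated by the relations
-- holding in the factors.  The proof that i lies in X is ignored.
module _ {I : Set ℓ} (G : I → Group ℓ ℓ) (X : Pred I ℓ) where

  private module G i = Group (G i)

  Generator : Set ℓ
  Generator = Σ[ i ∈ I ] X i × G.Carrier i

  infix 4 _≈*_

  data _≈*_ : Rel (List Generator) ℓ where
    refl*  : ∀ {u} → u ≈* u
    sym*   : ∀ {u v} → u ≈* v → v ≈* u
    trans* : ∀ {u v w} → u ≈* v → v ≈* w → u ≈* w
    ++*    : ∀ {u u′ v v′} → u ≈* u′ → v ≈* v′ → u ++ v ≈* u′ ++ v′
    ≈-rel  : ∀ {i p q x y} → G._≈_ i x y → [ i , p , x ] ≈* [ i , q , y ]
    ε-rel  : ∀ {i p} → [ i , p , G.ε i ] ≈* []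
    ∙-rel  : ∀ {i p q r x y} →
             (i , p , x) ∷ (i , q , y) ∷ [] ≈* [ i , r , G._∙_ i x y ]

  generator⁻¹ : Generator → Generator
  generator⁻¹ (i , p , x) = i , p , G._⁻¹ i x

  inverse* : List Generator → List Generator
  inverse* u = reverse (map generator⁻¹ u)

  private
    ≡⇒≈* : ∀ {u v} → u ≡ v → u ≈* v
    ≡⇒≈* ≡.refl = refl*

    inverse*-++ : ∀ u v → inverse* (u ++ v) ≡ inverse* v ++ inverse* u
    inverse*-++ u v = ≡.trans (≡.cong reverse (map-++ generator⁻¹ u v))
                              (reverse-++ (map generator⁻¹ u) (map generator⁻¹ v))

    inverse*-cong : ∀ {u v} → u ≈* v → inverse* u ≈* inverse* v
    inverse*-cong refl* = refl*
    inverse*-cong (sym* p) = sym* (inverse*-cong p)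
    inverse*-cong (trans* p q) = trans* (inverse*-cong p) (inverse*-cong q)
    inverse*-cong (++* {u} {u′} {v} {v′} p q) =
      trans* (≡⇒≈* (inverse*-++ u v))
        (trans* (++* (inverse*-cong q) (inverse*-cong p))
          (≡⇒≈* (≡.sym (inverse*-++ u′ v′))))
    inverse*-cong (≈-rel {i} e) = ≈-rel (G.⁻¹-cong i e)
    inverse*-cong (ε-rel {i} {p}) =
      trans* (≈-rel {q = p} (GroupProperties.ε⁻¹≈ε (G i))) ε-rel
    inverse*-cong (∙-rel {i} {p} {x = x} {y}) =
      trans* (∙-rel {r = p})
        (≈-rel (G.sym i (GroupProperties.⁻¹-anti-homo-∙ (G i) x y)))

    cancelˡ : ∀ g → generator⁻¹ g ∷ g ∷ [] ≈* []
    cancelˡ (i , p , x) =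
      trans* (∙-rel {r = p}) (trans* (≈-rel {q = p} (G.inverseˡ i x)) ε-rel)

    cancelʳ : ∀ g → g ∷ generator⁻¹ g ∷ [] ≈* []
    cancelʳ (i , p , x) =
      trans* (∙-rel {r = p}) (trans* (≈-rel {q = p} (G.inverseʳ i x)) ε-rel)

    between : ∀ u {v} w → v ≈* [] → u ++ v ++ w ≈* u ++ w
    between u w e = ++* (refl* {u}) (++* e (refl* {w}))

    inverse*-inverseʳ : ∀ u → u ++ inverse* u ≈* []
    inverse*-inverseʳ []      = refl*
    inverse*-inverseʳ (g ∷ u) =
      trans* (≡⇒≈* (≡.cong (g ∷_)
               (≡.trans (≡.cong (u ++_) (inverse*-++ [ g ] u))
                        (≡.sym (++-assoc u (inverse* u) [ generator⁻¹ g ])))))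
        (trans* (between [ g ] [ generator⁻¹ g ] (inverse*-inverseʳ u)) (cancelʳ g))

    inverse*-inverseˡ : ∀ u → inverse* u ++ u ≈* []
    inverse*-inverseˡ []      = refl*
    inverse*-inverseˡ (g ∷ u) =
      trans* (≡⇒≈* (≡.trans (≡.cong (_++ g ∷ u) (inverse*-++ [ g ] u))
                             (++-assoc (inverse* u) [ generator⁻¹ g ] (g ∷ u))))
        (trans* (between (inverse* u) u (cancelˡ g)) (inverse*-inverseˡ u))

  FreeProduct : Group ℓ ℓ
  FreeProduct = record
    { Carrier = List Generator
    ; _≈_     = _≈*_
    ; _∙_     = _++_
    ; ε       = []
    ; _⁻¹     = inverse*
    ; isGroup = record
      { isMonoid = record
        { isSemigroup = record
          { isMagma = record
            { isEquivalence = record { refl = refl* ; sym = sym* ; trans = trans* }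
            ; ∙-cong        = ++*
            }
          ; assoc = λ u v w → ≡⇒≈* (++-assoc u v w)
          }
        ; identity = (λ _ → refl*) , (λ u → ≡⇒≈* (++-identityʳ u))
        }
      ; inverse = inverse*-inverseˡ , inverse*-inverseʳ
      ; ⁻¹-cong = inverse*-cong
      }
    }

------------------------------------------------------------------------
-- Finite subsets of linearly ordered sets

module _ (O : StrictTotalOrder ℓ ℓ ℓ) where

  open StrictTotalOrder O

  Subset : Pred Carrier ℓ → StrictTotalOrder ℓ ℓ ℓ
  Subset P = On.strictTotalOrder {B = Σ Carrier P} O proj₁

  Finite : Pred Carrier ℓ → Set ℓ
  Finite P = ∃[ xs ] IsEnumeration (StrictTotalOrder.Eq.setoid (Subset P)) xs

  -- The list, without repetition and in increasing order, of the
  -- elements of a given list.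
  increasing : List Carrier → List Carrier
  increasing xs = sort (deduplicate _≟_ xs)
    where open Sort (StrictTotalOrderProperties.decTotalOrder O) using (sort)

  private
    open SetoidMembership Eq.setoid using () renaming (_∈_ to _∈O_)
    module ↭ = SetoidPermutation Eq.setoid
    module ↭ₚ = SetoidPermutationProperties Eq.setoid
    open Sort (StrictTotalOrderProperties.decTotalOrder O)
      using (SortingAlgorithm; sortingAlgorithm; sort; sort-↗)

    sort-↭ₛ : ∀ xs → sort xs ↭.↭ xs
    sort-↭ₛ = SortingAlgorithm.sort-↭ₛ sortingAlgorithm

  increasing-sorted : ∀ xs → AllPairs _<_ (increasing xs)
  increasing-sorted xs = AllPairs.zipWith ≤∧≉⇒< (≤-sorted , unique)
    where
    ≤-sorted = Linked⇒AllPairs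
      (StrictTotalOrderProperties.trans O) (sort-↗ (deduplicate _≟_ xs))
    unique = ↭ₚ.Unique-resp-↭ (↭.↭-sym (sort-↭ₛ (deduplicate _≟_ xs)))
      (Unique.deduplicate-! (StrictTotalOrder.decSetoid O) xs)
    ≤∧≉⇒< : ∀ {x y} → (StrictTotalOrderProperties._≤_ O x y) × ¬ (x ≈ y) → x < y
    ≤∧≉⇒< (inj₁ x<y , _)   = x<y
    ≤∧≉⇒< (inj₂ x≈y , x≉y) = contradiction x≈y x≉y

  increasing-enumerates : ∀ {xs} → IsEnumeration Eq.setoid xs →
                          IsEnumeration Eq.setoid (increasing xs)
  increasing-enumerates {xs} ∈xs x = ↭ₚ.∈-resp-↭ (↭.↭-sym (sort-↭ₛ _))
    (Enumeration.deduplicate⁺ (StrictTotalOrder.decSetoid O) ∈xs x)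

  increasing-unique : ∀ {xs ys} → AllPairs _<_ xs → AllPairs _<_ ys →
                      (∀ x → x ∈O xs → x ∈O ys) → (∀ x → x ∈O ys → x ∈O xs) →
                      Pointwise _≈_ xs ys
  increasing-unique [] [] _ _ = []
  increasing-unique [] (_ ∷ _) _ ⊇ = contradiction (⊇ _ (here Eq.refl)) λ ()
  increasing-unique (_ ∷ _) [] ⊆ _ = contradiction (⊆ _ (here Eq.refl)) λ ()
  increasing-unique {x ∷ xs} {y ∷ ys} (x< ∷ xs<) (y< ∷ ys<) ⊆ ⊇ =
    x≈y ∷ increasing-unique xs< ys<
      (λ z z∈ → tail x< x≈y z∈ (⊆ z (there z∈)))
      (λ z z∈ → tail y< (Eq.sym x≈y) z∈ (⊇ z (there z∈)))
    where
    above : ∀ {a z zs} → All (a <_) zs → z ∈O zs → a < z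
    above (a<b ∷ _) (here z≈b)  = <-respʳ-≈ (Eq.sym z≈b) a<b
    above (_ ∷ a<)  (there z∈)  = above a< z∈

    heads : x ∈O (y ∷ ys) → y ∈O (x ∷ xs) → x ≈ y
    heads (here e)   _          = e
    heads (there _)  (here e)   = Eq.sym e
    heads (there x∈) (there y∈) = contradiction (above y< x∈) (asym (above x< y∈))

    x≈y : x ≈ y
    x≈y = heads (⊆ x (here Eq.refl)) (⊇ y (here Eq.refl))

    tail : ∀ {a b z as bs} → All (a <_) as → a ≈ b → z ∈O as → z ∈O (b ∷ bs) → z ∈O bs
    tail a< a≈b z∈ (here z≈b)  =
      contradiction (above a< z∈) (irrefl (Eq.trans a≈b (Eq.sym z≈b)))
    tail _  _   _  (there z∈′) = z∈′

------------------------------------------------------------------------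
-- The complete free product

module _ {I : Set ℓ} (G : I → Group ℓ ℓ) where

  private module G i = Group (G i)

  Letter : Set ℓ
  Letter = Σ I G.Carrier

  infix 4 _≋_ _∈G_ _∈⋃G_

  -- Equality in the union of the G i, whose only common element is the
  -- identity.
  data _≋_ : Rel Letter ℓ where
    same : ∀ {i x y} → G._≈_ i x y → (i , x) ≋ (i , y)
    unit : ∀ {i j x y} → G._≈_ i x (G.ε i) → G._≈_ j y (G.ε j) → (i , x) ≋ (j , y)

  ≋-refl : ∀ {l} → l ≋ l
  ≋-refl {i , _} = same (G.refl i)

  ≋-sym : ∀ {l m} → l ≋ m → m ≋ l
  ≋-sym (same {i} e) = same (G.sym i e)
  ≋-sym (unit e f)   = unit f e

  ≋-trans : ∀ {l m n} → l ≋ m → m ≋ n → l ≋ n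
  ≋-trans (same {i} e) (same f)     = same (G.trans i e f)
  ≋-trans (same {i} e) (unit f g)   = unit (G.trans i e f) g
  ≋-trans (unit {j = j} e f) (same g) = unit e (G.trans j (G.sym j g) f)
  ≋-trans (unit e _) (unit _ g)     = unit e g

  _∈G_ : Letter → I → Set ℓ
  l ∈G i = ∃[ x ] l ≋ (i , x)

  _∈⋃G_ : Letter → List I → Set ℓ
  l ∈⋃G F = ∃[ i ] i ∈ F × l ∈G i

  -- Only finitely many positions carry letters of each G i, so orders on
  -- types in Set ℓ account for all words.
  record Word : Set (suc ℓ) where
    field
      positions   : StrictTotalOrder ℓ ℓ ℓ
    open StrictTotalOrder positions public
      using () renaming (Carrier to Position; _≈_ to _≈ₚ_; _<_ to _<ₚ_)
    field
      letter      : Position → Letter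
      letter-cong : ∀ {a b} → a ≈ₚ b → letter a ≋ letter b
      finite      : ∀ i → Finite positions (λ a → letter a ∈G i)

  open Word

  -- The domain of the restricted word W_F.
  restriction : Word → List I → StrictTotalOrder ℓ ℓ ℓ
  restriction W F = Subset (positions W) (λ a → letter W a ∈⋃G F)

  private
    module Restriction W F = StrictTotalOrder (restriction W F)

  restriction-finite : ∀ W F → Finite (positions W) (λ a → letter W a ∈⋃G F)
  restriction-finite W []      = [] , λ { (_ , _ , () , _) }
  restriction-finite W (i ∷ F)
    with xs , ∈xs ← finite W i | ys , ∈ys ← restriction-finite W F =
      map first xs ++ map later ys , enumerates
    where
    first : Σ (Position W) (λ a → letter W a ∈G i) → Restriction.Carrier W (i ∷ F)
    first (a , l) = a , i , here ≡.refl , l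

    later : Restriction.Carrier W F → Restriction.Carrier W (i ∷ F)
    later (a , j , j∈F , l) = a , j , there j∈F , l

    enumerates : IsEnumeration (Restriction.Eq.setoid W (i ∷ F)) (map first xs ++ map later ys)
    enumerates (a , j , here ≡.refl , l) =
      Any.++⁺ˡ (Any.map⁺ (∈xs (a , l)))
    enumerates (a , j , there j∈F , l) =
      Any.++⁺ʳ (map first xs) (Any.map⁺ (∈ys (a , j , j∈F , l)))

  generator : ∀ W F → Restriction.Carrier W F → Generator G (_∈ F)
  generator _ _ (_ , i , i∈F , x , _) = i , i∈F , x

  -- W_F as an element of the free product of the G i with i in F.
  ρ : ∀ F → Word → Group.Carrier (FreeProduct G (_∈ F))
  ρ F W = map (generator W F)
              (increasing (restriction W F) (proj₁ (restriction-finite W F)))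

  infix 4 _∼_

  -- Isomorphic words are equivalent, by ρ-unique below, so they need not
  -- be identified beforehand.
  _∼_ : Rel Word ℓ
  U ∼ V = ∀ F → Group._≈_ (FreeProduct G (_∈ F)) (ρ F U) (ρ F V)

  private
    letter⁻¹ : Letter → Letter
    letter⁻¹ (i , x) = i , G._⁻¹ i x

    letter⁻¹-cong : ∀ {l m} → l ≋ m → letter⁻¹ l ≋ letter⁻¹ m
    letter⁻¹-cong (same {i} e) = same (G.⁻¹-cong i e)
    letter⁻¹-cong (unit {i} {j} e f) = unit (inv i e) (inv j f)
      where
      inv : ∀ k {x} → G._≈_ k x (G.ε k) → G._≈_ k (G._⁻¹ k x) (G.ε k)
      inv k e = G.trans k (G.⁻¹-cong k e) (GroupProperties.ε⁻¹≈ε (G k))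

    letter⁻¹-involutive : ∀ l → letter⁻¹ (letter⁻¹ l) ≋ l
    letter⁻¹-involutive (i , x) = same (GroupProperties.⁻¹-involutive (G i) x)

    ∈G-⁻¹ : ∀ {l i} → l ∈G i → letter⁻¹ l ∈G i
    ∈G-⁻¹ {i = i} (x , e) = G._⁻¹ i x , letter⁻¹-cong e

    ∈G-⁻¹⁻ : ∀ {l i} → letter⁻¹ l ∈G i → l ∈G i
    ∈G-⁻¹⁻ {l} m = map₂ (≋-trans (≋-sym (letter⁻¹-involutive l))) (∈G-⁻¹ {letter⁻¹ l} m)

  emptyWord : Word
  emptyWord = record
    { positions   = record
      { Carrier            = Lift ℓ ⊥
      ; _≈_                = _≡_
      ; _<_                = λ ()
      ; isStrictTotalOrder = record
        { isStrictPartialOrder = record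
          { isEquivalence = ≡.isEquivalence
          ; irrefl        = λ { {()} }
          ; trans         = λ { {()} }
          ; <-resp-≈      = (λ { {()} }) , (λ { {()} })
          }
        ; compare = λ ()
        }
      }
    ; letter      = λ ()
    ; letter-cong = λ { {()} }
    ; finite      = λ i → [] , λ ()
    }
    where
    open import Data.Empty using (⊥)
    import Relation.Binary.PropositionalEquality.Properties as ≡

  infixl 7 _⌢_

  _⌢_ : Word → Word → Word
  U ⌢ V = record
    { positions   = record
      { isStrictTotalOrder = ⊎-<-isStrictTotalOrder
          (StrictTotalOrder.isStrictTotalOrder (positions U))
          (StrictTotalOrder.isStrictTotalOrder (positions V))
      }
    ; letter      = [ letter U , letter V ]′
    ; letter-cong = λ { (inj₁ e) → letter-cong U e ; (inj₂ e) → letter-cong V e }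
    ; finite      = λ i →
        let xs , ∈xs = finite U i ; ys , ∈ys = finite V i in
        map (λ (a , m) → inj₁ a , m) xs ++ map (λ (b , m) → inj₂ b , m) ys ,
        λ { (inj₁ a , m) → Any.++⁺ˡ (Any.map⁺ (Any.map inj₁ (∈xs (a , m))))
          ; (inj₂ b , m) → Any.++⁺ʳ (map _ xs) (Any.map⁺ (Any.map inj₂ (∈ys (b , m))))
          }
    }

  infix 8 _⁻

  _⁻ : Word → Word
  W ⁻ = record
    { positions   = Flip.strictTotalOrder (positions W)
    ; letter      = λ a → letter⁻¹ (letter W a)
    ; letter-cong = λ e → letter⁻¹-cong (letter-cong W e)
    ; finite      = λ i →
        let xs , ∈xs = finite W i in
        map (map₂ ∈G-⁻¹) xs , λ (a , m) → Any.map⁺ (∈xs (a , ∈G-⁻¹⁻ m))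
    }

  private
    ≋⇒≈* : ∀ {X : Pred I ℓ} {i j p q x y} → (i , x) ≋ (j , y) →
           _≈*_ G X [ i , p , x ] [ j , q , y ]
    ≋⇒≈* (same e) = ≈-rel e
    ≋⇒≈* {p = p} {q} (unit e f) =
      trans* (trans* (≈-rel {q = p} e) ε-rel) (sym* (trans* (≈-rel {q = q} f) ε-rel))

    generators-cong : ∀ W F {xs ys} → Pointwise (Restriction._≈_ W F) xs ys →
                      _≈*_ G (_∈ F) (map (generator W F) xs) (map (generator W F) ys)
    generators-cong W F [] = refl*
    generators-cong W F {(_ , _ , _ , _ , e) ∷ _} {(_ , _ , _ , _ , f) ∷ _} (a≈b ∷ r) =
      ++* (≋⇒≈* (≋-trans (≋-sym e) (≋-trans (letter-cong W a≈b) f)))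
          (generators-cong W F r)

    increasing′ : ∀ W F → List (Restriction.Carrier W F)
    increasing′ W F = increasing (restriction W F) (proj₁ (restriction-finite W F))

    sorted′ : ∀ W F → AllPairs (Restriction._<_ W F) (increasing′ W F)
    sorted′ W F = increasing-sorted (restriction W F) (proj₁ (restriction-finite W F))

    enumerates′ : ∀ W F → IsEnumeration (Restriction.Eq.setoid W F) (increasing′ W F)
    enumerates′ W F =
      increasing-enumerates (restriction W F) (proj₂ (restriction-finite W F))

  -- Any increasing enumeration of the positions of W_F computes ρ F W.
  ρ-unique : ∀ W F {xs} → AllPairs (Restriction._<_ W F) xs →
             IsEnumeration (Restriction.Eq.setoid W F) xs →
             _≈*_ G (_∈ F) (ρ F W) (map (generator W F) xs)
  ρ-unique W F sorted ∈xs = generators-cong W F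
    (increasing-unique (restriction W F) (sorted′ W F) sorted
      (λ a _ → ∈xs a) (λ a _ → enumerates′ W F a))

  ρ-ε : ∀ F → _≈*_ G (_∈ F) (ρ F emptyWord) []
  ρ-ε F = ρ-unique emptyWord F [] λ ()

  ρ-⌢ : ∀ F U V → _≈*_ G (_∈ F) (ρ F (U ⌢ V)) (ρ F U ++ ρ F V)
  ρ-⌢ F U V = trans* (ρ-unique (U ⌢ V) F sorted enumerates) (≡⇒ equal)
    where
    ≡⇒ : ∀ {u v} → u ≡ v → _≈*_ G (_∈ F) u v
    ≡⇒ ≡.refl = refl*

    left : Restriction.Carrier U F → Restriction.Carrier (U ⌢ V) F
    left (a , m) = inj₁ a , m

    right : Restriction.Carrier V F → Restriction.Carrier (U ⌢ V) F
    right (b , m) = inj₂ b , m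

    xs = increasing′ U F
    ys = increasing′ V F

    sorted : AllPairs (Restriction._<_ (U ⌢ V) F) (map left xs ++ map right ys)
    sorted = AllPairs.++⁺
      (AllPairs.map⁺ (AllPairs.map ₁∼₁ (sorted′ U F)))
      (AllPairs.map⁺ (AllPairs.map ₂∼₂ (sorted′ V F)))
      (All.map⁺ (All.universal (λ _ → All.map⁺ (All.universal (λ _ → ₁∼₂) ys)) xs))

    enumerates : IsEnumeration (Restriction.Eq.setoid (U ⌢ V) F) (map left xs ++ map right ys)
    enumerates (inj₁ a , m) = Any.++⁺ˡ (Any.map⁺ (Any.map inj₁ (enumerates′ U F (a , m))))
    enumerates (inj₂ b , m) =
      Any.++⁺ʳ (map left xs) (Any.map⁺ (Any.map inj₂ (enumerates′ V F (b , m))))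

    equal : map (generator (U ⌢ V) F) (map left xs ++ map right ys) ≡ ρ F U ++ ρ F V
    equal = ≡.trans (map-++ (generator (U ⌢ V) F) (map left xs) (map right ys))
      (≡.cong₂ _++_ (≡.sym (map-∘ xs)) (≡.sym (map-∘ ys)))

  ρ-⁻ : ∀ F W → _≈*_ G (_∈ F) (ρ F (W ⁻)) (inverse* G (_∈ F) (ρ F W))
  ρ-⁻ F W = trans* (ρ-unique (W ⁻) F sorted enumerates) (≡⇒ equal)
    where
    ≡⇒ : ∀ {u v} → u ≡ v → _≈*_ G (_∈ F) u v
    ≡⇒ ≡.refl = refl*

    inv : Restriction.Carrier W F → Restriction.Carrier (W ⁻) F
    inv (a , i , i∈F , m) = a , i , i∈F , ∈G-⁻¹ m

    xs = increasing′ W F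

    AllPairs-reverse : ∀ {A : Set ℓ} {R : Rel A ℓ} {as} →
                       AllPairs R as → AllPairs (flip R) (reverse as)
    AllPairs-reverse [] = []
    AllPairs-reverse {as = a ∷ as} (r ∷ rs) = ≡.subst (AllPairs _)
      (≡.sym (reverse-++ [ a ] as))
      (AllPairs.++⁺ (AllPairs-reverse rs) ([] ∷ [])
        (All.tabulate λ b∈ → All.lookup r (Any.reverse⁻ b∈) ∷ []))

    sorted : AllPairs (Restriction._<_ (W ⁻) F) (reverse (map inv xs))
    sorted = AllPairs-reverse (AllPairs.map⁺ (sorted′ W F))

    enumerates : IsEnumeration (Restriction.Eq.setoid (W ⁻) F) (reverse (map inv xs))
    enumerates (a , i , i∈F , m) = Any.reverse⁺
      (Any.map⁺ (enumerates′ W F (a , i , i∈F , ∈G-⁻¹⁻ m)))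

    equal : map (generator (W ⁻) F) (reverse (map inv xs)) ≡ inverse* G (_∈ F) (ρ F W)
    equal = ≡.trans (reverse-map (generator (W ⁻) F) (map inv xs))
      (≡.cong reverse (≡.trans (≡.sym (map-∘ xs)) (map-∘ xs)))

  CompleteFreeProduct : Group (suc ℓ) ℓ
  CompleteFreeProduct = record
    { Carrier = Word
    ; _≈_     = _∼_
    ; _∙_     = _⌢_
    ; ε       = emptyWord
    ; _⁻¹     = _⁻
    ; isGroup = record
      { isMonoid = record
        { isSemigroup = record
          { isMagma = record
            { isEquivalence = record
              { refl  = λ F → refl*
              ; sym   = λ p F → sym* (p F)
              ; trans = λ p q F → trans* (p F) (q F)
              }
            ; ∙-cong = λ {U} {U′} {V} {V′} p q F →
                trans* (ρ-⌢ F U V) (trans* (++* (p F) (q F)) (sym* (ρ-⌢ F U′ V′)))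
            }
          ; assoc = λ U V W F →
              trans* (trans* (ρ-⌢ F (U ⌢ V) W) (++* (ρ-⌢ F U V) refl*))
                (trans* (P.assoc F (ρ F U) (ρ F V) (ρ F W))
                  (sym* (trans* (ρ-⌢ F U (V ⌢ W)) (++* (refl* {u = ρ F U}) (ρ-⌢ F V W)))))
          }
        ; identity =
            (λ W F → trans* (ρ-⌢ F emptyWord W) (++* (ρ-ε F) refl*)) ,
            (λ W F → trans* (ρ-⌢ F W emptyWord)
              (trans* (++* (refl* {u = ρ F W}) (ρ-ε F)) (P.identityʳ F (ρ F W))))
        }
      ; inverse =
          (λ W F → trans* (ρ-⌢ F (W ⁻) W) (trans* (++* (ρ-⁻ F W) refl*)
            (trans* (P.inverseˡ F (ρ F W)) (sym* (ρ-ε F))))) ,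
          (λ W F → trans* (ρ-⌢ F W (W ⁻)) (trans* (++* (refl* {u = ρ F W}) (ρ-⁻ F W))
            (trans* (P.inverseʳ F (ρ F W)) (sym* (ρ-ε F)))))
      ; ⁻¹-cong = λ {U} {V} p F →
          trans* (ρ-⁻ F U) (trans* (P.⁻¹-cong F (p F)) (sym* (ρ-⁻ F V)))
      }
    }
    where module P F = Group (FreeProduct G (_∈ F))

-- Homomorphisms to the additive group of integers.
IsHomomorphismToℤ : ∀ {a b} (H : Group a b) → (Group.Carrier H → ℤ) → Set (a ⊔ b)
IsHomomorphismToℤ H = IsGroupHomomorphism (Group.rawGroup H) (AbelianGroup.rawGroup +-0-abelianGroup)

{-# OPTIONS --safe #-}

-- Let Z β be the word with one non-trivial letter for each α ≥ β in κ, in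
-- decreasing order of α.  In a Cayley tree, Z β and Z γ agree near their
-- common starting point, and H is the set of elements that set off along
-- this germ: the W for which some Z β lies on the way from 1 to W.  The
-- set H is almost invariant under right translations, so that
-- φ W = |{P ∉ H : P W ∈ H}| - |{P ∈ H : P W ∉ H}| is a homomorphism.
-- Infinitely many P in one of these sets would, at some β above a
-- countable set of bounds in κ, give infinitely many crossings of the
-- finitely many letters of W with index β.  Finally φ (Z β) = 1 for all β,
-- although for large β no letter of Z β lies in a given finite set of
-- factors.
--
-- No normal forms are needed: the indicator η of the elements beyond Z β
-- is the number of arrivals at Z β minus the number of departures from
-- Z β along letters of the factor β, which is invariant under the
-- relations of the finite free products because it telescopes along
-- letters of a single factor.

module Submission where

open import Defs
open import Algebra.Bundles using (Group)
open import Algebra.Morphism.Structures using (IsGroupHomomorphism)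
import Algebra.Properties.Group as GroupProperties
open import Axiom.ExcludedMiddle using (ExcludedMiddle)
open import Data.Empty using (⊥-elim)
import Data.Fin.Base as Fin
open import Data.Fin.Properties using (pigeonhole)
open import Data.Integer.Base using (ℤ; 0ℤ; 1ℤ; _+_; _-_; _*_; -_)
open import Data.Integer.Properties using (+-identityʳ; +-identityˡ; +-inverseʳ; +-assoc)
open import Data.Integer.Tactic.RingSolver using (solve-∀)
open import Data.List.Base using (List; []; _∷_; [_]; _++_; map; length; lookup; concatMap)
open import Data.List.Membership.Propositional using (_∈_)
import Data.List.Membership.Setoid as SetoidMembership
import Data.List.Membership.Setoid.Properties as Membership
open import Data.List.Properties using (++-assoc; ++-identityʳ; map-++; map-∘; concatMap-++)
open import Data.List.Relation.Binary.Subset.Propositional using (_⊆_)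
open import Data.List.Relation.Binary.Subset.Propositional.Properties
  using (xs⊆xs++ys; xs⊆ys++xs)
open import Data.List.Relation.Unary.All as All using (All; []; _∷_)
import Data.List.Relation.Unary.All.Properties as All
open import Data.List.Relation.Unary.AllPairs as AllPairs using (AllPairs; []; _∷_)
import Data.List.Relation.Unary.AllPairs.Properties as AllPairs
open import Data.List.Relation.Unary.Any as Any using (here; there; Any)
import Data.List.Relation.Unary.Any.Properties as Any
open import Data.Nat.Base using (ℕ; zero; suc)
import Data.Nat.Base as ℕ
import Data.Nat.Properties as ℕ
open import Data.Product.Base using (Σ; Σ-syntax; ∃-syntax; _×_; _,_; proj₁; proj₂)
open import Data.Sum.Base using (_⊎_; inj₁; inj₂; [_,_]′)
open import Data.Unit.Polymorphic.Base using (⊤)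
open import Function.Base using (_∘_)
open import Function.Bundles using (_↣_; mk↣; Injection)
open import Induction.WellFounded using (Acc; acc)
open import Level using (Level)
open import Relation.Binary.Bundles using (Setoid; StrictTotalOrder)
import Relation.Binary.Construct.Flip.EqAndOrd as Flip
open import Relation.Binary.Core using (_Preserves_⟶_)
open import Relation.Binary.Definitions using (tri<; tri≈; tri>)
open import Relation.Binary.PropositionalEquality.Core as ≡ using (_≡_; _≢_; refl; cong; cong₂)
open import Relation.Binary.PropositionalEquality.Properties using (module ≡-Reasoning)
import Relation.Binary.Reasoning.Setoid as SetoidReasoning
open import Relation.Binary.Structures using (IsStrictTotalOrder)
open import Relation.Nullary.Decidable.Core using (Dec; yes; no)
open import Relation.Nullary.Negation.Core using (¬_; contradiction)
open import Relation.Unary using (Pred)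

private
  variable
    a b ℓ : Level
    P : Set a
    Q : Set b

-- Integer indicators.

𝟙 : Dec P → ℤ
𝟙 (yes _) = 1ℤ
𝟙 (no  _) = 0ℤ

𝟙-true : (a? : Dec P) → P → 𝟙 a? ≡ 1ℤ
𝟙-true (yes _) _ = refl
𝟙-true (no ¬a) a = contradiction a ¬a

𝟙-false : (a? : Dec P) → ¬ P → 𝟙 a? ≡ 0ℤ
𝟙-false (yes a) ¬a = contradiction a ¬a
𝟙-false (no _)  _  = refl

𝟙-cong : (P → Q) → (Q → P) → (a? : Dec P) (b? : Dec Q) → 𝟙 a? ≡ 𝟙 b?
𝟙-cong f g (yes a) b? = ≡.sym (𝟙-true b? (f a))
𝟙-cong f g (no ¬a) b? = ≡.sym (𝟙-false b? (¬a ∘ g))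

-- Finitely supported sums over a setoid.

module FiniteSums (em : ∀ {a} → ExcludedMiddle a) {a ℓ} (S : Setoid a ℓ) where

  open Setoid S renaming (refl to ≈-refl; sym to ≈-sym; trans to ≈-trans)
  open SetoidMembership S using () renaming (_∈_ to _∈ˢ_; _∉_ to _∉ˢ_)

  private
    variable
      f g : Carrier → ℤ
      xs ys : List Carrier

  weigh : Dec P → ℤ → ℤ
  weigh (yes _) _ = 0ℤ
  weigh (no  _) n = n

  -- Entries equal to a later one are skipped.
  ∑ : (Carrier → ℤ) → List Carrier → ℤ
  ∑ f []       = 0ℤ
  ∑ f (x ∷ xs) = weigh (em {P = x ∈ˢ xs}) (f x) + ∑ f xs

  -- Zeros of `f` and repetitions may occur in the list, so supports can be enlarged and
  -- concatenated freely.
  _SupportedBy_ : (Carrier → ℤ) → List Carrier → Set _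
  f SupportedBy xs = ∀ x → f x ≢ 0ℤ → x ∈ˢ xs

  ∑-cong : (∀ x → f x ≡ g x) → ∀ xs → ∑ f xs ≡ ∑ g xs
  ∑-cong f≗g []       = refl
  ∑-cong f≗g (x ∷ xs) = cong₂ _+_ (cong (weigh (em {P = x ∈ˢ xs})) (f≗g x)) (∑-cong f≗g xs)

  ∑-singleton : ∀ f x → ∑ f [ x ] ≡ f x
  ∑-singleton f x with em {P = x ∈ˢ []}
  ... | no _ = +-identityʳ _

  ∑-+ : ∀ f g xs → ∑ (λ x → f x + g x) xs ≡ ∑ f xs + ∑ g xs
  ∑-+ f g []       = refl
  ∑-+ f g (x ∷ xs) rewrite ∑-+ f g xs with em {P = x ∈ˢ xs}
  ... | yes _ = solve₀ (∑ f xs) (∑ g xs)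
    where
    solve₀ : ∀ m n → 0ℤ + (m + n) ≡ 0ℤ + m + (0ℤ + n)
    solve₀ = solve-∀
  ... | no _ = solve₁ (f x) (g x) (∑ f xs) (∑ g xs)
    where
    solve₁ : ∀ p q m n → p + q + (m + n) ≡ p + m + (q + n)
    solve₁ = solve-∀

  ∑-zero : (∀ x → f x ≡ 0ℤ) → ∀ xs → ∑ f xs ≡ 0ℤ
  ∑-zero f≗0 [] = refl
  ∑-zero f≗0 (x ∷ xs) with em {P = x ∈ˢ xs}
  ... | yes _ = ≡.trans (+-identityˡ _) (∑-zero f≗0 xs)
  ... | no _  = cong₂ _+_ (f≗0 x) (∑-zero f≗0 xs)

  private
    -- `f at x` is the part of `f` on the class of `x` and `f off x` the remainder; for an `f` that
    -- respects equality they add up to `f`.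
    _at_ _off_ : (Carrier → ℤ) → Carrier → Carrier → ℤ
    (f at x)  y = 𝟙 (em {P = y ≈ x}) * f x
    (f off x) y = weigh (em {P = y ≈ x}) (f y)

    split : f Preserves _≈_ ⟶ _≡_ → ∀ x y → f y ≡ (f at x) y + (f off x) y
    split {f} f-cong x y with em {P = y ≈ x}
    ... | yes y≈x = ≡.trans (f-cong y≈x) (solve₀ (f x))
      where
      solve₀ : ∀ n → n ≡ 1ℤ * n + 0ℤ
      solve₀ = solve-∀
    ... | no _ = ≡.sym (+-identityˡ (f y))

    ∑-at-∉ : ∀ f {x} xs → x ∉ˢ xs → ∑ (f at x) xs ≡ 0ℤ
    ∑-at-∉ f [] x∉ = refl
    ∑-at-∉ f {x} (y ∷ ys) x∉ with em {P = y ∈ˢ ys}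
    ... | yes _ = ≡.trans (+-identityˡ _) (∑-at-∉ f ys (x∉ ∘ there))
    ... | no _ rewrite 𝟙-false (em {P = y ≈ x}) (x∉ ∘ here ∘ ≈-sym) =
      ≡.trans (+-identityˡ _) (∑-at-∉ f ys (x∉ ∘ there))

    -- Of the entries equal to `x` only the last is counted, so `f x` is contributed once.
    ∑-at-∈ : ∀ f {x} xs → x ∈ˢ xs → ∑ (f at x) xs ≡ f x
    ∑-at-∈ f {x} (y ∷ ys) x∈ with em {P = y ∈ˢ ys}
    ∑-at-∈ f {x} (y ∷ ys) (here x≈y) | yes y∈ =
      ≡.trans (+-identityˡ _) (∑-at-∈ f ys (Membership.∈-resp-≈ S (≈-sym x≈y) y∈))
    ∑-at-∈ f {x} (y ∷ ys) (there x∈) | yes y∈ =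
      ≡.trans (+-identityˡ _) (∑-at-∈ f ys x∈)
    ... | no y∉ with em {P = y ≈ x}
    ...   | yes y≈x = ≡.trans
      (cong (1ℤ * f x +_) (∑-at-∉ f ys (y∉ ∘ Membership.∈-resp-≈ S (≈-sym y≈x))))
      (solve₀ (f x))
      where
      solve₀ : ∀ n → 1ℤ * n + 0ℤ ≡ n
      solve₀ = solve-∀
    ...   | no y≉x = ≡.trans (+-identityˡ _) (∑-at-∈ f ys (Any.tail (y≉x ∘ ≈-sym) x∈))

    ∑-at : ∀ f {x} → f SupportedBy xs → ∑ (f at x) xs ≡ f x
    ∑-at {xs = xs} f {x} supp with em {P = x ∈ˢ xs} | em {P = f x ≡ 0ℤ}
    ... | yes x∈ | _       = ∑-at-∈ f xs x∈
    ... | no x∉  | yes fx≡0 = ≡.trans (∑-at-∉ f xs x∉) (≡.sym fx≡0)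
    ... | no x∉  | no fx≢0  = contradiction (supp x fx≢0) x∉

    ∑-off : f Preserves _≈_ ⟶ _≡_ → ∀ {x} → f SupportedBy xs →
            ∑ f xs ≡ f x + ∑ (f off x) xs
    ∑-off {f} {xs} f-cong {x} supp = ≡.trans (∑-cong (split f-cong x) xs)
      (≡.trans (∑-+ (f at x) (f off x) xs) (cong (_+ ∑ (f off x) xs) (∑-at f supp)))

    off-cong : f Preserves _≈_ ⟶ _≡_ → ∀ {x} → (f off x) Preserves _≈_ ⟶ _≡_
    off-cong f-cong {x} {y} {z} y≈z with em {P = y ≈ x} | em {P = z ≈ x}
    ... | yes _   | yes _   = refl
    ... | yes y≈x | no z≉x  = contradiction (≈-trans (≈-sym y≈z) y≈x) z≉x
    ... | no y≉x  | yes z≈x = contradiction (≈-trans y≈z z≈x) y≉x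
    ... | no _    | no _    = f-cong y≈z

    off-≢0 : ∀ {x y} → (f off x) y ≢ 0ℤ → ¬ (y ≈ x) × f y ≢ 0ℤ
    off-≢0 {x = x} {y} ≢0 with em {P = y ≈ x}
    ... | yes _  = contradiction refl ≢0
    ... | no y≉x = y≉x , ≢0

    ∑-drop : ∀ {x} xs → f x ≡ 0ℤ → ∑ f (x ∷ xs) ≡ ∑ f xs
    ∑-drop {f} {x} xs fx≡0 with em {P = x ∈ˢ xs}
    ... | yes _ = +-identityˡ _
    ... | no _  = ≡.trans (cong (_+ ∑ f xs) fx≡0) (+-identityˡ _)

    off-self : ∀ f x → (f off x) x ≡ 0ℤ
    off-self f x with em {P = x ≈ x}
    ... | yes _ = refl
    ... | no x≉x = contradiction ≈-refl x≉x

  -- Induction on the first list: splitting off the class of its head leaves a function supported by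
  -- the tail, while `ys` still supports it.
  ∑-unique : f Preserves _≈_ ⟶ _≡_ → f SupportedBy xs → f SupportedBy ys →
             ∑ f xs ≡ ∑ f ys
  ∑-unique {f} {[]} {ys} f-cong xs-supp ys-supp = ≡.sym (∑-zero f≗0 ys)
    where
    f≗0 : ∀ x → f x ≡ 0ℤ
    f≗0 x with em {P = f x ≡ 0ℤ}
    ... | yes fx≡0 = fx≡0
    ... | no fx≢0 = contradiction (xs-supp x fx≢0) λ ()
  ∑-unique {f} {x ∷ xs} {ys} f-cong xs-supp ys-supp = begin
    ∑ f (x ∷ xs)                ≡⟨ ∑-off f-cong xs-supp ⟩
    f x + ∑ (f off x) (x ∷ xs)  ≡⟨ cong (f x +_) (∑-drop xs (off-self f x)) ⟩
    f x + ∑ (f off x) xs        ≡⟨ cong (f x +_) (∑-unique (off-cong f-cong)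
                                     off-xs (λ y → ys-supp y ∘ proj₂ ∘ off-≢0 {f})) ⟩
    f x + ∑ (f off x) ys        ≡⟨ ∑-off f-cong ys-supp ⟨
    ∑ f ys                      ∎
    where
    open ≡-Reasoning
    off-xs : (f off x) SupportedBy xs
    off-xs y ≢0 = let y≉x , fy≢0 = off-≢0 {f} ≢0 in Any.tail y≉x (xs-supp y fy≢0)

  -- Since `θ` preserves and reflects equality, the same entries are skipped on both sides.
  ∑-map : ∀ θ → θ Preserves _≈_ ⟶ _≈_ → (∀ {x y} → θ x ≈ θ y → x ≈ y) →
          ∀ f xs → ∑ f (map θ xs) ≡ ∑ (f ∘ θ) xs
  ∑-map θ θ-cong θ-inj f [] = refl
  ∑-map θ θ-cong θ-inj f (x ∷ xs)
    with em {P = θ x ∈ˢ map θ xs} | em {P = x ∈ˢ xs}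
  ... | yes _  | yes _ = cong (0ℤ +_) (∑-map θ θ-cong θ-inj f xs)
  ... | no _   | no _  = cong (f (θ x) +_) (∑-map θ θ-cong θ-inj f xs)
  ... | yes θ∈ | no x∉ = contradiction (Any.map θ-inj (Any.map⁻ θ∈)) x∉
  ... | no θ∉  | yes x∈ = contradiction (Any.map⁺ (Any.map θ-cong x∈)) θ∉

  -- Otherwise one could list arbitrarily many of them without repetition.
  finitely-many : ∀ {p} (P : Pred Carrier p)
    (bounded : (s : ℕ → Carrier) → (∀ n → P (s n)) → ∃[ cover ] (∀ n → s n ∈ˢ cover)) →
    ∃[ xs ] (∀ x → P x → x ∈ˢ xs)
  finitely-many P bounded with em {P = ∃[ xs ] (∀ x → P x → x ∈ˢ xs)}
  ... | yes found = found
  -- One more term of the sequence than `cover` has entries: two terms must share an entry, yet each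
  -- term is new.
  ... | no none   = ⊥-elim (collision (pigeonhole (ℕ.n<1+n (length cover))
                                          (Any.index ∘ ∈cover ∘ Fin.toℕ)))
    where
    fresh : ∀ xs → ∃[ x ] P x × x ∉ˢ xs
    fresh xs with em {P = ∃[ x ] P x × x ∉ˢ xs}
    ... | yes found = found
    ... | no ¬fresh = contradiction (xs , covered) none
      where
      covered : ∀ x → P x → x ∈ˢ xs
      covered x px with em {P = x ∈ˢ xs}
      ... | yes x∈ = x∈
      ... | no x∉  = contradiction (x , px , x∉) ¬fresh

    earlier : ℕ → List Carrier
    earlier zero    = []
    earlier (suc n) = proj₁ (fresh (earlier n)) ∷ earlier n

    s : ℕ → Carrier
    s n = proj₁ (fresh (earlier n))

    cover = proj₁ (bounded s (λ n → proj₁ (proj₂ (fresh (earlier n)))))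
    ∈cover = proj₂ (bounded s (λ n → proj₁ (proj₂ (fresh (earlier n)))))

    earlier-∈ : ∀ {m n} → m ℕ.<′ n → s m ∈ˢ earlier n
    earlier-∈ ℕ.<′-base = here ≈-refl
    earlier-∈ (ℕ.≤′-step m<n) = there (earlier-∈ m<n)

    same-index : ∀ {x y} (x∈ : x ∈ˢ cover) (y∈ : y ∈ˢ cover) →
                 Any.index x∈ ≡ Any.index y∈ → x ≈ y
    same-index x∈ y∈ eq = ≈-trans (Any.lookup-index x∈)
      (≈-trans (reflexive (cong (lookup cover) eq)) (≈-sym (Any.lookup-index y∈)))

    collision : ¬ (∃[ i ] ∃[ j ] i Fin.< j ×
                   Any.index (∈cover (Fin.toℕ i)) ≡ Any.index (∈cover (Fin.toℕ j)))
    collision (i , j , i<j , eq) = proj₂ (proj₂ (fresh (earlier (Fin.toℕ j))))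
      (Membership.∈-resp-≈ S (same-index (∈cover (Fin.toℕ i)) (∈cover (Fin.toℕ j)) eq)
        (earlier-∈ (ℕ.<⇒<′ i<j)))

-- Cofinality in a regular uncountable cardinal.

module RegularUncountable (em : ∀ {a} → ExcludedMiddle a) {ℓ} (κ : Cardinal ℓ)
  (regular : Regular κ) (uncountable : Uncountable κ) where

  open Cardinal κ
  open IsStrictTotalOrder isStrictTotalOrder
    using (compare) renaming (trans to <-trans; irrefl to <-irrefl)

  least : (P : Pred Carrier ℓ) → ∃[ x ] P x → ∃[ x ] P x × (∀ y → P y → ¬ (y < x))
  least P (x , px) = go x px (wellFounded x)
    where
    go : ∀ x → P x → Acc _<_ x → ∃[ x ] P x × (∀ y → P y → ¬ (y < x))
    go x px (acc rs) with em {P = ∃[ y ] P y × y < x}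
    ... | yes (y , py , y<x) = go y py (rs y<x)
    ... | no none = x , px , λ y py y<x → none (y , py , y<x)

  point : Carrier
  point with em {P = Carrier}
  ... | yes x = x
  ... | no ¬x = contradiction
    (mk↣ {to = λ x → contradiction x ¬x} (λ {x} _ → contradiction x ¬x)) uncountable

  private
    other : ∀ x → ∃[ y ] y ≢ x
    other x with em {P = ∃[ y ] y ≢ x}
    ... | yes found = found
    ... | no none = contradiction
      (mk↣ {to = λ _ → 0} (λ {y} {z} _ → ≡.trans (is-x y) (≡.sym (is-x z)))) uncountable
      where
      is-x : ∀ y → y ≡ x
      is-x y with em {P = y ≡ x}
      ... | yes y≡x = y≡x
      ... | no y≢x = contradiction (y , y≢x) none

    increasing-pair : ∃[ x ] ∃[ y ] x < y
    increasing-pair with other point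
    ... | y , y≢ with compare y point
    ...   | tri< y< _ _ = y , point , y<
    ...   | tri≈ _ y≡ _ = contradiction y≡ y≢
    ...   | tri> _ _ <y = point , y , <y

  -- Regularity for a constant function; its bound speaks only of arguments below `q`, hence the
  -- pair `p < q`.
  above : ∀ x → ∃[ y ] x < y
  above x = let p , q , p<q = increasing-pair
                y , bound = regular q (λ _ → x)
            in y , bound p p<q

  private
    next : ∀ x → ∃[ y ] x < y × (∀ z → x < z → ¬ (z < y))
    next x = least (x <_) (above x)

    bottom : ∃[ x ] (∀ y → ¬ (y < x))
    bottom = let x , _ , min = least (λ x → x ≡ x) (point , refl) in x , λ y → min y refl

    finite-ordinal : ℕ → Carrier
    finite-ordinal zero    = proj₁ bottom
    finite-ordinal (suc n) = proj₁ (next (finite-ordinal n))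

    -- The finite ordinals cannot exhaust an uncountable `κ`, and by induction an element outside
    -- them exceeds them all.
    ω-below : ∃[ x ] (∀ n → finite-ordinal n < x)
    ω-below with em {P = ∃[ x ] (∀ n → x ≢ finite-ordinal n)}
    ... | yes (x , x≢) = x , below
      where
      below : ∀ n → finite-ordinal n < x
      below zero with compare (finite-ordinal zero) x
      ... | tri< lt _ _ = lt
      ... | tri≈ _ eq _ = contradiction (≡.sym eq) (x≢ zero)
      ... | tri> _ _ gt = contradiction gt (proj₂ bottom x)
      below (suc n) with compare (finite-ordinal (suc n)) x
      ... | tri< lt _ _ = lt
      ... | tri≈ _ eq _ = contradiction (≡.sym eq) (x≢ (suc n))
      ... | tri> _ _ gt =
        contradiction gt (proj₂ (proj₂ (next (finite-ordinal n))) x (below n))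
    ... | no none = contradiction (mk↣ {to = proj₁ ∘ index} index-inj) uncountable
      where
      index : ∀ x → ∃[ n ] x ≡ finite-ordinal n
      index x with em {P = ∃[ n ] x ≡ finite-ordinal n}
      ... | yes found = found
      ... | no ¬found = contradiction (x , λ n eq → ¬found (n , eq)) none
      index-inj : ∀ {x y} → proj₁ (index x) ≡ proj₁ (index y) → x ≡ y
      index-inj {x} {y} eq = ≡.trans (proj₂ (index x))
        (≡.trans (cong finite-ordinal eq) (≡.sym (proj₂ (index y))))

    finite-ordinal-< : ∀ {m n} → m ℕ.<′ n → finite-ordinal m < finite-ordinal n
    finite-ordinal-< {m} ℕ.<′-base = proj₁ (proj₂ (next (finite-ordinal m)))
    finite-ordinal-< (ℕ.≤′-step {n} m<n) =
      <-trans (finite-ordinal-< m<n) (proj₁ (proj₂ (next (finite-ordinal n))))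

    finite-ordinal-inj : ∀ {m n} → finite-ordinal m ≡ finite-ordinal n → m ≡ n
    finite-ordinal-inj {m} {n} eq with ℕ.<-cmp m n
    ... | tri< lt _ _ = contradiction (finite-ordinal-< (ℕ.<⇒<′ lt)) (<-irrefl eq)
    ... | tri≈ _ m≡n _ = m≡n
    ... | tri> _ _ gt = contradiction (finite-ordinal-< (ℕ.<⇒<′ gt)) (<-irrefl (≡.sym eq))

  -- Indexing the sequence by the finite ordinals, which lie below a common `q`, turns it into a
  -- function that regularity bounds below `q`.
  countable-sup : (s : ℕ → Carrier) → ∃[ x ] (∀ n → s n < x)
  countable-sup s = let q , ω<q = ω-below
                        x , bound = regular q extend
                    in x , λ n → ≡.subst (_< x) (extend-finite n) (bound _ (ω<q n))
    where
    extend : Carrier → Carrier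
    extend x with em {P = ∃[ n ] x ≡ finite-ordinal n}
    ... | yes (n , _) = s n
    -- A default value: the bound is read off at finite ordinals.
    ... | no _        = x
    extend-finite : ∀ n → extend (finite-ordinal n) ≡ s n
    extend-finite n with em {P = ∃[ m ] finite-ordinal n ≡ finite-ordinal m}
    ... | yes (m , eq) = cong s (≡.sym (finite-ordinal-inj eq))
    ... | no none      = contradiction (n , refl) none

  upper-bound : ∀ x y → ∃[ z ] x < z × y < z
  upper-bound x y = let z , bound = countable-sup (λ { zero → x ; (suc _) → y })
                    in z , bound 0 , bound 1

-- Maps out of a free product.

module Fold {I : Set ℓ} {G : I → Group ℓ ℓ} {X : Pred I ℓ} (Γ : Group a b) where

  private
    module Γ = Group Γ
    module G i = Group (G i)

  module _ (f : ∀ i → G.Carrier i → Γ.Carrier)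
    (f-cong : ∀ {i x y} → G._≈_ i x y → f i x Γ.≈ f i y)
    (f-ε    : ∀ i → f i (G.ε i) Γ.≈ Γ.ε)
    (f-∙    : ∀ i x y → f i (G._∙_ i x y) Γ.≈ f i x Γ.∙ f i y) where

    fold : List (Generator G X) → Γ.Carrier
    fold []              = Γ.ε
    fold ((i , _ , x) ∷ u) = f i x Γ.∙ fold u

    private
      fold-++ : ∀ u v → fold (u ++ v) Γ.≈ fold u Γ.∙ fold v
      fold-++ []      v = Γ.sym (Γ.identityˡ _)
      fold-++ (s ∷ u) v = Γ.trans (Γ.∙-congˡ (fold-++ u v)) (Γ.sym (Γ.assoc _ _ _))

    fold-cong : ∀ {u v} → _≈*_ G X u v → fold u Γ.≈ fold v
    fold-cong refl*         = Γ.refl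
    fold-cong (sym* e)      = Γ.sym (fold-cong e)
    fold-cong (trans* e e′) = Γ.trans (fold-cong e) (fold-cong e′)
    fold-cong (++* {u} {u′} {v} {v′} e e′) = Γ.trans (fold-++ u v)
      (Γ.trans (Γ.∙-cong (fold-cong e) (fold-cong e′)) (Γ.sym (fold-++ u′ v′)))
    fold-cong (≈-rel e)     = Γ.∙-congʳ (f-cong e)
    fold-cong ε-rel         = Γ.trans (Γ.identityʳ _) (f-ε _)
    fold-cong ∙-rel         = Γ.trans (Γ.sym (Γ.assoc _ _ _)) (Γ.∙-congʳ (Γ.sym (f-∙ _ _ _)))

-- Crossing counts in a free product.

module Crossings (em : ∀ {a} → ExcludedMiddle a) {I : Set ℓ} (G : I → Group ℓ ℓ)
  (X : Pred I ℓ) (b : I) (z : List (Generator G X)) where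

  private
    infix 4 _≈_
    _≈_ = _≈*_ G X

    ≡⇒≈ : ∀ {u v} → u ≡ v → u ≈ v
    ≡⇒≈ refl = refl*

    variable
      u v x y : List (Generator G X)

  at : List (Generator G X) → ℤ
  at x = 𝟙 (em {P = x ≈ z})

  at-cong : x ≈ y → at x ≡ at y
  at-cong x≈y = 𝟙-cong (trans* (sym* x≈y)) (trans* x≈y) em em

  step : List (Generator G X) → Generator G X → ℤ
  step x s = 𝟙 (em {P = proj₁ s ≡ b}) * (at (x ++ [ s ]) - at x)

  -- Reading u from the starting point x, arrivals at z minus departures
  -- from z along letters of G b.
  crossings : List (Generator G X) → List (Generator G X) → ℤ
  crossings x []      = 0ℤ
  crossings x (s ∷ u) = step x s + crossings (x ++ [ s ]) u

  crossings-congˡ : ∀ u → x ≈ y → crossings x u ≡ crossings y u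
  crossings-congˡ []      x≈y = refl
  crossings-congˡ (s ∷ u) x≈y = cong₂ _+_
    (cong₂ (λ m n → 𝟙 (em {P = proj₁ s ≡ b}) * (m - n)) (at-cong (++* x≈y refl*)) (at-cong x≈y))
    (crossings-congˡ u (++* x≈y refl*))

  crossings-++ : ∀ x u v → crossings x (u ++ v) ≡ crossings x u + crossings (x ++ u) v
  crossings-++ x []      v = ≡.trans
    (crossings-congˡ v (≡⇒≈ (≡.sym (++-identityʳ x)))) (≡.sym (+-identityˡ _))
  crossings-++ x (s ∷ u) v = ≡.trans
    (cong (step x s +_) (≡.trans (crossings-++ (x ++ [ s ]) u v)
      (cong (crossings (x ++ [ s ]) u +_)
        (cong (λ y → crossings y v) (++-assoc x [ s ] u)))))
    (≡.sym (+-assoc (step x s) _ _))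

  -- Both sides of each relation of a factor have the same end points, and
  -- the count along letters of a single factor telescopes.
  crossings-congʳ : ∀ x → u ≈ v → crossings x u ≡ crossings x v
  crossings-congʳ x refl*         = refl
  crossings-congʳ x (sym* e)      = ≡.sym (crossings-congʳ x e)
  crossings-congʳ x (trans* e e′) = ≡.trans (crossings-congʳ x e) (crossings-congʳ x e′)
  crossings-congʳ x (++* {u} {u′} {v} {v′} e e′) = ≡.trans (crossings-++ x u v)
    (≡.trans
      (cong₂ _+_ (crossings-congʳ x e)
        (≡.trans (crossings-congʳ (x ++ u) e′) (crossings-congˡ v′ (++* refl* e))))
      (≡.sym (crossings-++ x u′ v′)))
  crossings-congʳ x (≈-rel {i} e) = cong (λ n → 𝟙 (em {P = i ≡ b}) * (n - at x) + 0ℤ)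
    (at-cong (++* (refl* {u = x}) (≈-rel e)))
  crossings-congʳ x (ε-rel {i} {p}) = ≡.trans
    (cong (λ n → 𝟙 (em {P = i ≡ b}) * (n - at x) + 0ℤ)
      (at-cong (trans* (++* (refl* {u = x}) (ε-rel {p = p})) (≡⇒≈ (++-identityʳ x)))))
    (vanish (𝟙 (em {P = i ≡ b})) (at x))
    where
    vanish : ∀ d n → d * (n - n) + 0ℤ ≡ 0ℤ
    vanish = solve-∀
  crossings-congʳ x (∙-rel {i} {p} {q} {r} {g} {h}) = ≡.trans
    (cong (λ n → d * (at (x ++ [ s ]) - at x) + (d * (n - at (x ++ [ s ])) + 0ℤ))
      (at-cong (trans* (≡⇒≈ (++-assoc x [ s ] _)) (++* (refl* {u = x}) (∙-rel {r = r})))))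
    (telescope d (at x) (at (x ++ [ s ])) (at (x ++ [ i , r , Group._∙_ (G i) g h ])))
    where
    s = i , p , g
    d = 𝟙 (em {P = i ≡ b})
    telescope : ∀ d l m n → d * (m - l) + (d * (n - m) + 0ℤ) ≡ d * (n - l) + 0ℤ
    telescope = solve-∀

  crossings-free : ∀ x → All (λ s → proj₁ s ≢ b) u → crossings x u ≡ 0ℤ
  crossings-free x [] = refl
  crossings-free {s ∷ u} x (s≢ ∷ u≢)
    rewrite 𝟙-false (em {P = proj₁ s ≡ b}) s≢ | crossings-free (x ++ [ s ]) u≢ = refl

  crossings-single : ∀ x {p g} → crossings x [ b , p , g ] ≡ at (x ++ [ b , p , g ]) - at x
  crossings-single x {p} {g} rewrite 𝟙-true (em {P = b ≡ b}) refl =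
    simplify (at (x ++ [ b , p , g ])) (at x)
    where
    simplify : ∀ m n → 1ℤ * (m - n) + 0ℤ ≡ m - n
    simplify = solve-∀

-- Evaluating words in the finite free products.

module Evaluation (em : ∀ {a} → ExcludedMiddle a) {I : Set ℓ} (G : I → Group ℓ ℓ) where

  open Word

  private
    module G i = Group (G i)

    infix 4 _⊢_≈_
    _⊢_≈_ : (F : List I) → (u v : List (Generator G (_∈ F))) → Set ℓ
    F ⊢ u ≈ v = _≈*_ G (_∈ F) u v

    ≡⇒≈ : ∀ {F u v} → u ≡ v → F ⊢ u ≈ v
    ≡⇒≈ refl = refl*

  -- Letters of factors outside `F` become trivial, so that the same list of letters can be
  -- evaluated for different `F`.
  value : ∀ F → Letter G → List (Generator G (_∈ F))
  value F (i , x) with em {P = i ∈ F}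
  ... | yes p = [ i , p , x ]
  ... | no _  = []

  values : ∀ F → List (Letter G) → List (Generator G (_∈ F))
  values F = concatMap (value F)

  value-ε : ∀ F {i x} → G._≈_ i x (G.ε i) → F ⊢ value F (i , x) ≈ []
  value-ε F {i} e with em {P = i ∈ F}
  ... | yes p = trans* (≈-rel {q = p} e) ε-rel
  ... | no _  = refl*

  value-cong : ∀ F {l m} → _≋_ G l m → F ⊢ value F l ≈ value F m
  value-cong F (same {i} e) with em {P = i ∈ F}
  ... | yes p = ≈-rel e
  ... | no _  = refl*
  value-cong F (unit e f) = trans* (value-ε F e) (sym* (value-ε F f))

  value-∙ : ∀ F i x y → F ⊢ value F (i , G._∙_ i x y) ≈ value F (i , x) ++ value F (i , y)
  value-∙ F i x y with em {P = i ∈ F}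
  ... | yes p = sym* ∙-rel
  ... | no _  = refl*

  value-∈ : ∀ {F i x} (p : i ∈ F) → F ⊢ [ i , p , x ] ≈ value F (i , x)
  value-∈ {F} {i} p with em {P = i ∈ F}
  ... | yes _ = ≈-rel (G.refl i)
  ... | no i∉ = contradiction p i∉

  value-∉ : ∀ {F} l → ¬ (_∈⋃G_ G l F) → value F l ≡ []
  value-∉ {F} (i , x) l∉ with em {P = i ∈ F}
  ... | yes p = contradiction (i , p , x , ≋-refl G) l∉
  ... | no _  = refl

  -- Further positions are allowed; their letters evaluate to the empty list. So a list made for `F`
  -- also covers any subset of `F`.
  Covers : (W : Word G) → List I → List (Position W) → Set ℓ
  Covers W F as = ∀ a → _∈⋃G_ G (letter W a) F → Any (_≈ₚ_ W a) as

  module _ (W : Word G) (F : List I) where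

    private
      module W = StrictTotalOrder (positions W)
      module R = StrictTotalOrder (restriction G W F)

      keep : List (Position W) → List R.Carrier
      keep []       = []
      keep (a ∷ as) with em {P = _∈⋃G_ G (letter W a) F}
      ... | yes m = (a , m) ∷ keep as
      ... | no _  = keep as

      keep-> : ∀ {a as} → All (a W.<_) as → All ((a W.<_) ∘ proj₁) (keep as)
      keep-> [] = []
      keep-> {as = c ∷ _} (a<c ∷ a<as) with em {P = _∈⋃G_ G (letter W c) F}
      ... | yes m = a<c ∷ keep-> a<as
      ... | no _  = keep-> a<as

      keep-sorted : ∀ {as} → AllPairs W._<_ as → AllPairs R._<_ (keep as)
      keep-sorted [] = []
      keep-sorted {c ∷ _} (c< ∷ sorted) with em {P = _∈⋃G_ G (letter W c) F}
      ... | yes m = keep-> c< ∷ keep-sorted sorted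
      ... | no _  = keep-sorted sorted

      keep-∈ : ∀ {as} (r : R.Carrier) → Any (proj₁ r W.≈_) as → Any (r R.≈_) (keep as)
      keep-∈ {c ∷ as} (a , i , i∈F , x , e) a∈ with em {P = _∈⋃G_ G (letter W c) F} | a∈
      ... | yes m | here a≈c  = here a≈c
      ... | yes m | there a∈′ = there (keep-∈ (a , i , i∈F , x , e) a∈′)
      ... | no _  | there a∈′ = keep-∈ (a , i , i∈F , x , e) a∈′
      ... | no c∉ | here a≈c  = contradiction
        (i , i∈F , x , ≋-trans G (letter-cong W (W.Eq.sym a≈c)) e) c∉

      keep-values : ∀ as → F ⊢ map (generator G W F) (keep as) ≈ values F (map (letter W) as)
      keep-values [] = refl*
      keep-values (a ∷ as) with em {P = _∈⋃G_ G (letter W a) F}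
      ... | yes (i , i∈F , x , e) = ++*
        (trans* (value-∈ i∈F) (value-cong F (≋-sym G e))) (keep-values as)
      ... | no a∉ = trans* (keep-values as)
        (≡⇒≈ (cong (_++ values F (map (letter W) as)) (≡.sym (value-∉ (letter W a) a∉))))

    -- Deleting the positions with letters outside `F` leaves an increasing enumeration of the
    -- domain of `W_F`, and the deleted letters have empty value.
    ρ≈values : ∀ {as} → AllPairs (_<ₚ_ W) as → Covers W F as →
               F ⊢ ρ G F W ≈ values F (map (letter W) as)
    ρ≈values {as} sorted covers = trans*
      (ρ-unique G W F (keep-sorted sorted) (λ r → keep-∈ r (covers (proj₁ r) (proj₂ r))))
      (keep-values as)

    lineup : List (Position W)
    lineup = map proj₁ (increasing (restriction G W F) (proj₁ (restriction-finite G W F)))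

    lineup-sorted : AllPairs (_<ₚ_ W) lineup
    lineup-sorted = AllPairs.map⁺
      (increasing-sorted (restriction G W F) (proj₁ (restriction-finite G W F)))

    lineup-covers : Covers W F lineup
    lineup-covers a m = Any.map⁺
      (increasing-enumerates (restriction G W F) (proj₂ (restriction-finite G W F)) (a , m))

    ρ≈lineup : F ⊢ ρ G F W ≈ values F (map (letter W) lineup)
    ρ≈lineup = ρ≈values lineup-sorted lineup-covers

  -- Killing the factors outside `E` is a homomorphism. It carries `ρ G F W` to `ρ G E W`, because
  -- the lineup for `F` covers `E` too. Consequently words that differ at `E` differ at every larger
  -- set.
  ρ-⊆ : ∀ {E F} → E ⊆ F → ∀ U V → F ⊢ ρ G F U ≈ ρ G F V → E ⊢ ρ G E U ≈ ρ G E V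
  ρ-⊆ {E} {F} E⊆F U V e = trans* (sym* (project-ρ U)) (trans* (project-cong e) (project-ρ V))
    where
    open Fold {G = G} {X = _∈ F} (FreeProduct G (_∈ E))
    project = fold (λ i x → value E (i , x)) (λ e → value-cong E (same e))
                (λ i → value-ε E (G.refl i)) (value-∙ E)
    project-cong = λ {u} {v} → fold-cong (λ i x → value E (i , x)) (λ e → value-cong E (same e))
                (λ i → value-ε E (G.refl i)) (value-∙ E) {u} {v}

    project-values : ∀ ls → project (values F ls) ≡ values E ls
    project-values [] = refl
    project-values ((i , x) ∷ ls) with em {P = i ∈ F}
    ... | yes _ = cong (value E (i , x) ++_) (project-values ls)
    ... | no i∉ with em {P = i ∈ E}
    ...   | yes p = contradiction (E⊆F p) i∉
    ...   | no _  = project-values ls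

    project-ρ : ∀ W → E ⊢ project (ρ G F W) ≈ ρ G E W
    project-ρ W = trans* (project-cong (ρ≈lineup W F))
      (trans* (≡⇒≈ (project-values (map (letter W) (lineup W F))))
        (sym* (ρ≈values W E (lineup-sorted W F)
          (λ a (i , i∈E , m) → lineup-covers W F a (i , E⊆F i∈E , m)))))

-- Restricting words to sets of positions.

module Restriction (em : ∀ {a} → ExcludedMiddle a) {I : Set ℓ} (G : I → Group ℓ ℓ) where

  open Word
  open Evaluation em G
  private module G i = Group (G i)

  infixl 8 _∣_

  _∣_ : (W : Word G) → Pred (Position W) ℓ → Word G
  W ∣ R = record
    { positions   = Subset (positions W) R
    ; letter      = letter W ∘ proj₁
    ; letter-cong = letter-cong W
    ; finite      = λ i → keep i (proj₁ (finite W i)) ,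
                    λ ((a , r) , m) → keep-∈ i r m (proj₂ (finite W i) (a , m))
    }
    where
    module W = StrictTotalOrder (positions W)

    keep : ∀ i → List (Σ (Position W) λ a → _∈G_ G (letter W a) i) →
           List (Σ (Σ (Position W) R) λ a → _∈G_ G (letter W (proj₁ a)) i)
    keep i [] = []
    -- `R` need not respect equality of positions, so a representative in `R` of the listed position
    -- is looked for.
    keep i ((c , m) ∷ cs) with em {P = ∃[ a ] R a × a W.≈ c}
    ... | yes (a , r , a≈c) =
      ((a , r) , proj₁ m , ≋-trans G (letter-cong W a≈c) (proj₂ m)) ∷ keep i cs
    ... | no _              = keep i cs

    keep-∈ : ∀ i {a} (r : R a) (m : _∈G_ G (letter W a) i) {cs} →
             Any (λ c → a W.≈ proj₁ c) cs → Any (λ c → a W.≈ proj₁ (proj₁ c)) (keep i cs)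
    keep-∈ i {a} r m {(c , _) ∷ cs} a∈ with em {P = ∃[ a ] R a × a W.≈ c} | a∈
    ... | yes (_ , _ , d≈c) | here a≈c  = here (W.Eq.trans a≈c (W.Eq.sym d≈c))
    ... | yes _             | there a∈′ = there (keep-∈ i r m a∈′)
    ... | no _              | there a∈′ = keep-∈ i r m a∈′
    ... | no none           | here a≈c  = contradiction (a , r , a≈c) none

  private
    values-++ : ∀ F ls ms → values F (ls ++ ms) ≡ values F ls ++ values F ms
    values-++ F = concatMap-++ (value F)

  -- The lineups of the two parts, one after the other, form an increasing list that covers `F` in
  -- the whole, so both sides have the same value.
  ∣-split : ∀ W {R R₁ R₂ : Pred (Position W) ℓ} →
            (∀ {a} → R₁ a → R a) → (∀ {a} → R₂ a → R a) → (∀ {a} → R a → R₁ a ⊎ R₂ a) →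
            (∀ {a c} → R₁ a → R₂ c → _<ₚ_ W a c) →
            _∼_ G (W ∣ R) (_⌢_ G (W ∣ R₁) (W ∣ R₂))
  ∣-split W {R} {R₁} {R₂} R₁⊆R R₂⊆R cover R₁<R₂ F = trans*
    (ρ≈values (W ∣ R) F sorted covers)
    (trans* (≡⇒≈ equal)
      (sym* (trans* (ρ-⌢ G F (W ∣ R₁) (W ∣ R₂))
        (++* (ρ≈lineup (W ∣ R₁) F) (ρ≈lineup (W ∣ R₂) F)))))
    where
    ≡⇒≈ : ∀ {u v} → u ≡ v → _≈*_ G (_∈ F) u v
    ≡⇒≈ refl = refl*

    left : Position (W ∣ R₁) → Position (W ∣ R)
    left (a , r) = a , R₁⊆R r

    right : Position (W ∣ R₂) → Position (W ∣ R)
    right (a , r) = a , R₂⊆R r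

    as = lineup (W ∣ R₁) F
    cs = lineup (W ∣ R₂) F

    sorted : AllPairs (_<ₚ_ (W ∣ R)) (map left as ++ map right cs)
    sorted = AllPairs.++⁺ (AllPairs.map⁺ (lineup-sorted (W ∣ R₁) F))
      (AllPairs.map⁺ (lineup-sorted (W ∣ R₂) F))
      (All.map⁺ (All.universal
        (λ (_ , r) → All.map⁺ (All.universal (λ (_ , s) → R₁<R₂ r s) cs)) as))

    covers : Covers (W ∣ R) F (map left as ++ map right cs)
    covers (a , r) m with cover r
    ... | inj₁ r₁ = Any.++⁺ˡ (Any.map⁺ (lineup-covers (W ∣ R₁) F (a , r₁) m))
    ... | inj₂ r₂ = Any.++⁺ʳ (map left as) (Any.map⁺ (lineup-covers (W ∣ R₂) F (a , r₂) m))

    equal : values F (map (letter (W ∣ R)) (map left as ++ map right cs)) ≡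
            values F (map (letter (W ∣ R₁)) as) ++ values F (map (letter (W ∣ R₂)) cs)
    equal = ≡.trans
      (cong (values F) (≡.trans (map-++ (letter (W ∣ R)) (map left as) (map right cs))
        (cong₂ _++_ (≡.sym (map-∘ as)) (≡.sym (map-∘ cs)))))
      (values-++ F (map (letter (W ∣ R₁)) as) _)

-- Decomposition of words and limits of crossing counts.

module Paths (em : ∀ {a} → ExcludedMiddle a) {I : Set ℓ} (G : I → Group ℓ ℓ) where

  open Word
  open Evaluation em G
  open Restriction em G
  open Group (CompleteFreeProduct G)
    using (_≈_; _∙_; ε; setoid; sym; trans; assoc; identityˡ; identityʳ; ∙-congˡ)
  private
    module G i = Group (G i)

    infix 4 _⊢_≈_
    _⊢_≈_ : (F : List I) → (u v : List (Generator G (_∈ F))) → Set ℓ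
    F ⊢ u ≈ v = _≈*_ G (_∈ F) u v

    variable
      c d : I
      A B U V W Z : Word G

  ∣-all : ∀ W {R : Pred (Position W) ℓ} → (∀ a → R a) → W ≈ W ∣ R
  ∣-all W {R} all F = trans*
    (ρ≈values W F (AllPairs.map⁺ (lineup-sorted (W ∣ R) F))
      (λ a m → Any.map⁺ (lineup-covers (W ∣ R) F (a , all a) m)))
    (≡.subst (λ ls → F ⊢ values F ls ≈ ρ G F (W ∣ R)) (map-∘ (lineup (W ∣ R) F))
      (sym* (ρ≈lineup (W ∣ R) F)))

  -- Trivial letters lie in every factor, so a free word has none at all.
  Free : I → Pred (Word G) ℓ
  Free c W = ∀ a → ¬ (_∈G_ G (letter W a) c)

  Single : I → Pred (Word G) ℓ
  Single c W = Σ[ p ∈ Position W ] (∀ a → _≈ₚ_ W a p) ×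
    (Σ[ x ∈ G.Carrier c ] _≋_ G (letter W p) (c , x) × ¬ (G._≈_ c x (G.ε c)))

  private
    ρ-point : ∀ F p → (∀ a → _≈ₚ_ W a p) → F ⊢ ρ G F W ≈ value F (letter W p)
    ρ-point {W} F p ≈p = ≡.subst (F ⊢ ρ G F W ≈_) (++-identityʳ _)
      (ρ≈values W F ([] ∷ []) (λ a _ → here (≈p a)))

    ρ-Single : ∀ {F} (c∈F : c ∈ F) ((_ , _ , x , _) : Single c B) →
               F ⊢ ρ G F B ≈ [ c , c∈F , x ]
    ρ-Single {F = F} c∈F (p , ≈p , x , e , _) =
      trans* (ρ-point F p ≈p) (trans* (value-cong F e) (sym* (value-∈ c∈F)))

    ρ-Free : ∀ {F} → Free c A → All (λ s → proj₁ s ≢ c) (ρ G F A)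
    ρ-Free free = All.map⁺ (All.universal
      (λ { (a , i , _ , x , e) refl → free a (x , e) }) _)

    trivial-point : ∀ p → (∀ a → _≈ₚ_ W a p) → ∀ {i x} →
                    _≋_ G (letter W p) (i , x) → G._≈_ i x (G.ε i) → W ≈ ε
    trivial-point p ≈p e x≈ε F = trans* (ρ-point F p ≈p)
      (trans* (value-cong F e) (trans* (value-ε F x≈ε) (sym* (ρ-ε G F))))

  -- Distinct factors have only the identity in common, and the letter of a `Single` word is
  -- non-trivial.
  Single⇒Free : c ≢ d → Single c B → Free d B
  Single⇒Free {B = B} c≢d (p , ≈p , x , e , x≉ε) a (y , e′)
    with ≋-trans G (≋-sym G e)
           (≋-trans G (letter-cong B (StrictTotalOrder.Eq.sym (positions B) (≈p a))) e′)
  ... | same _     = c≢d refl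
  ... | unit x≈ε _ = x≉ε x≈ε

  -- The coordinate map from the free product over `[ c ]` to `G c` recovers the letter of `B`,
  -- which is not the identity.
  Single⇒≉ε : Single c B → ¬ (B ≈ ε)
  Single⇒≉ε {c} {B} single@(p , ≈p , x , e , x≉ε) B≈ε = x≉ε
    (G.trans c (G.sym c (G.trans c (G.identityʳ c _) factor-self))
      (coordinate-cong (trans* (sym* (ρ-Single {B = B} (here refl) single))
        (trans* (B≈ε [ c ]) (ρ-ε G [ c ])))))
    where
    factor : ∀ i → G.Carrier i → G.Carrier c
    factor i x with em {P = i ≡ c}
    ... | yes refl = x
    ... | no _     = G.ε c

    factor-self : G._≈_ c (factor c x) x
    factor-self with em {P = c ≡ c}
    ... | yes refl = G.refl c
    ... | no c≢c = contradiction refl c≢c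

    factor-cong : ∀ {i x y} → G._≈_ i x y → G._≈_ c (factor i x) (factor i y)
    factor-cong {i} e with em {P = i ≡ c}
    ... | yes refl = e
    ... | no _     = G.refl c

    factor-ε : ∀ i → G._≈_ c (factor i (G.ε i)) (G.ε c)
    factor-ε i with em {P = i ≡ c}
    ... | yes refl = G.refl c
    ... | no _     = G.refl c

    factor-∙ : ∀ i x y → G._≈_ c (factor i (G._∙_ i x y)) (G._∙_ c (factor i x) (factor i y))
    factor-∙ i x y with em {P = i ≡ c}
    ... | yes refl = G.refl c
    ... | no _     = G.sym c (G.identityˡ c _)

    coordinate-cong = λ {u} {v} → Fold.fold-cong {G = G} {X = _∈ [ c ]} (G c)
      factor factor-cong factor-ε factor-∙ {u} {v}

  -- Cut W at its finitely many positions carrying letters of the G c.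
  path-induction : ∀ {q} (cs : List I) (Q : Pred (Word G) q) →
    (∀ {U V} → U ≈ V → Q U → Q V) → Q ε →
    (∀ {X A} → (∀ {c} → c ∈ cs → Free c A) → Q X → Q (X ∙ A)) →
    (∀ {X B c} → c ∈ cs → Single c B → Q X → Q (X ∙ B)) →
    ∀ W → Q W
  path-induction cs Q Q-cong Q-ε Q-free Q-single W =
    Q-cong (trans (identityˡ _) (sym (∣-all W {λ _ → ⊤} _)))
      (go (lineup W cs) (λ a _ → lineup-covers W cs a) Q-ε)
    where
    open StrictTotalOrder (positions W)
      using (_<_; compare) renaming (_≈_ to _≈ₓ_; module Eq to ≈ₓ; irrefl to <-irrefl;
        <-respˡ-≈ to <-respˡ)

    point-step : ∀ {X} p {R : Pred (Position W) ℓ} → (∀ {a} → R a → a ≈ₓ p) →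
                 Q X → Q (X ∙ W ∣ R)
    point-step {X} p {R} R⊆p q with em {P = ∃[ a ] R a × _∈⋃G_ G (letter W a) cs}
    ... | no none = Q-free (λ c∈ (a , r) m → none (a , r , _ , c∈ , m)) q
    ... | yes (a , r , c , c∈ , x , e) = from em
      where
      ≈a : (d : Position (W ∣ R)) → proj₁ d ≈ₓ a
      ≈a (d , s) = ≈ₓ.trans (R⊆p s) (≈ₓ.sym (R⊆p r))

      from : Dec (G._≈_ c x (G.ε c)) → Q (X ∙ W ∣ R)
      from (yes x≈ε) = Q-cong (sym (trans
        (∙-congˡ {X} (trivial-point {W = W ∣ R} (a , r) ≈a e x≈ε)) (identityʳ X))) q
      from (no x≉ε) = Q-single c∈ ((a , r) , ≈a , x , e , x≉ε) q

    go : ∀ ps {R : Pred (Position W) ℓ} {X} →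
         (∀ a → R a → _∈⋃G_ G (letter W a) cs → Any (a ≈ₓ_) ps) →
         Q X → Q (X ∙ W ∣ R)
    go [] covers q = Q-free (λ c∈ (a , r) m → contradiction (covers a r (_ , c∈ , m)) λ ()) q
    -- Cut `R` into the parts before, at and after `p`. Entries equal to `p` account for no position
    -- of the outer parts, so `ps` still covers both.
    go (p ∷ ps) {R} {X} covers q = Q-cong (sym regroup)
      (go ps (λ a (r , p<a) m → Any.tail (λ a≈p → <-irrefl (≈ₓ.sym a≈p) p<a) (covers a r m))
        (point-step p proj₂
          (go ps (λ a (r , a<p) m → Any.tail (λ a≈p → <-irrefl a≈p a<p) (covers a r m)) q)))
      where
      R< = λ a → R a × a < p
      R≈ = λ a → R a × a ≈ₓ p
      R> = λ a → R a × p < a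
      R≥ = λ a → R≈ a ⊎ R> a

      forget : ∀ {a} → R≥ a → R a
      forget (inj₁ (r , _)) = r
      forget (inj₂ (r , _)) = r

      trichotomy : ∀ {a} → R a → R< a ⊎ R≥ a
      trichotomy {a} r with compare a p
      ... | tri< lt _ _ = inj₁ (r , lt)
      ... | tri≈ _ eq _ = inj₂ (inj₁ (r , eq))
      ... | tri> _ _ gt = inj₂ (inj₂ (r , gt))

      <-≥ : ∀ {a d} → R< a → R≥ d → a < d
      <-≥ (_ , a<p) (inj₁ (_ , d≈p)) = StrictTotalOrder.<-respʳ-≈ (positions W) (≈ₓ.sym d≈p) a<p
      <-≥ (_ , a<p) (inj₂ (_ , p<d)) = StrictTotalOrder.trans (positions W) a<p p<d

      ≈-> : ∀ {a d} → R≈ a → R> d → a < d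
      ≈-> (_ , a≈p) (_ , p<d) = <-respˡ (≈ₓ.sym a≈p) p<d

      regroup : X ∙ W ∣ R ≈ X ∙ W ∣ R< ∙ W ∣ R≈ ∙ W ∣ R>
      regroup = begin
        X ∙ W ∣ R
          ≈⟨ ∙-congˡ {X} (∣-split W {R} {R<} {R≥} proj₁ forget trichotomy <-≥) ⟩
        X ∙ (W ∣ R< ∙ W ∣ R≥)
          ≈⟨ assoc X (W ∣ R<) (W ∣ R≥) ⟨
        X ∙ W ∣ R< ∙ W ∣ R≥
          ≈⟨ ∙-congˡ {X ∙ W ∣ R<} (∣-split W {R≥} {R≈} {R>} inj₁ inj₂ (λ r → r) ≈->) ⟩
        X ∙ W ∣ R< ∙ (W ∣ R≈ ∙ W ∣ R>)
          ≈⟨ assoc (X ∙ W ∣ R<) (W ∣ R≈) (W ∣ R>) ⟨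
        X ∙ W ∣ R< ∙ W ∣ R≈ ∙ W ∣ R>
          ∎
        where open SetoidReasoning setoid

  module _ (c : I) (Z : Word G) where

    private
      module Cr F = Crossings em G (_∈ F) c (ρ G F Z)

    infix 4 _⟶_

    -- Convergence in the discrete set of integers, along the finite sets of factors directed by
    -- inclusion.
    _⟶_ : Word G → ℤ → Set ℓ
    W ⟶ n = Σ[ F₀ ∈ List I ] (∀ F → F₀ ⊆ F → Cr.crossings F [] (ρ G F W) ≡ n)

    private
      -- Distinct elements are separated by some finite set of factors, and by `ρ-⊆` by every larger
      -- one.
      at-limit : ∀ W → Σ[ F₀ ∈ List I ] (∀ F → F₀ ⊆ F →
                 Cr.at F (ρ G F W) ≡ 𝟙 (em {P = W ≈ Z}))
      at-limit W with em {P = W ≈ Z}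
      ... | yes W≈Z = [] , λ F _ → 𝟙-true em (W≈Z F)
      ... | no W≉Z with em {P = Σ[ F₀ ∈ List I ] ¬ (F₀ ⊢ ρ G F₀ W ≈ ρ G F₀ Z)}
      ...   | yes (F₀ , ≉) = F₀ , λ F F₀⊆F → 𝟙-false em (≉ ∘ ρ-⊆ F₀⊆F W Z)
      ...   | no none = contradiction equal W≉Z
        where
        equal : W ≈ Z
        equal F with em {P = F ⊢ ρ G F W ≈ ρ G F Z}
        ... | yes e = e
        ... | no ≉  = contradiction (F , ≉) none

      ⟶-unique : ∀ {W m n} → W ⟶ m → W ⟶ n → m ≡ n
      ⟶-unique (E , e) (F , f) =
        ≡.trans (≡.sym (e (E ++ F) (xs⊆xs++ys E F))) (f (E ++ F) (xs⊆ys++xs F E))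

      ⟶-cong : ∀ {U V n} → U ≈ V → U ⟶ n → V ⟶ n
      ⟶-cong U≈V (F₀ , e) = F₀ , λ F F₀⊆F →
        ≡.trans (Cr.crossings-congʳ F [] (sym* (U≈V F))) (e F F₀⊆F)

      ⟶-ε : ε ⟶ 0ℤ
      ⟶-ε = [] , λ F _ → Cr.crossings-congʳ F [] (ρ-ε G F)

      ρ-∙ : ∀ F U V → Cr.crossings F [] (ρ G F (U ∙ V)) ≡
            Cr.crossings F [] (ρ G F U) + Cr.crossings F (ρ G F U) (ρ G F V)
      ρ-∙ F U V = ≡.trans (Cr.crossings-congʳ F [] (ρ-⌢ G F U V))
        (Cr.crossings-++ F [] (ρ G F U) (ρ G F V))

      ⟶-free : ∀ {X A n} → Free c A → X ⟶ n → X ∙ A ⟶ n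
      ⟶-free {X} {A} free (F₀ , e) = F₀ , λ F F₀⊆F → ≡.trans (ρ-∙ F X A)
        (≡.trans (cong₂ _+_ (e F F₀⊆F) (Cr.crossings-free F (ρ G F X) (ρ-Free {A = A} free)))
          (+-identityʳ _))

      -- As soon as `F` contains `c`, the word `B` is read as one letter of that factor; for still
      -- larger `F` the indicators at its two ends are final.
      ⟶-single : ∀ {X B n} → Single c B → X ⟶ n →
                 X ∙ B ⟶ n + (𝟙 (em {P = X ∙ B ≈ Z}) - 𝟙 (em {P = X ≈ Z}))
      ⟶-single {X} {B} single (F₀ , e) =
        let E₁ , e₁ = at-limit (X ∙ B) ; E₂ , e₂ = at-limit X in
        c ∷ F₀ ++ E₁ ++ E₂ , λ F ⊆F → ≡.trans (ρ-∙ F X B)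
          (cong₂ _+_ (e F (⊆F ∘ there ∘ xs⊆xs++ys F₀ _))
            (≡.trans (Cr.crossings-congʳ F (ρ G F X) (ρ-Single {B = B} (⊆F (here refl)) single))
              (≡.trans (Cr.crossings-single F (ρ G F X))
                (cong₂ _-_
                  (≡.trans
                    (Cr.at-cong F (sym* (trans* (ρ-⌢ G F X B)
                      (++* refl* (ρ-Single {B = B} (⊆F (here refl)) single)))))
                    (e₁ F (⊆F ∘ there ∘ xs⊆ys++xs _ F₀ ∘ xs⊆xs++ys E₁ E₂)))
                  (e₂ F (⊆F ∘ there ∘ xs⊆ys++xs _ F₀ ∘ xs⊆ys++xs E₂ E₁))))))

      abstract
        -- Only the finitely many letters of `G c` change the limit, each by a difference of two
        -- indicators.
        limit : ∀ W → ∃[ n ] W ⟶ n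
        limit = path-induction [ c ] (λ W → ∃[ n ] W ⟶ n)
          (λ {U} {V} U≈V (n , l) → n , ⟶-cong {U} {V} U≈V l)
          (0ℤ , ⟶-ε)
          (λ {X} {A} free (n , l) → n , ⟶-free {X} {A} (free (here refl)) l)
          (λ { {X} {B} (here refl) single (n , l) → _ , ⟶-single {X} {B} single l })

    η : Word G → ℤ
    η W = proj₁ (limit W)

    η-cong : U ≈ V → η U ≡ η V
    η-cong {U} {V} U≈V =
      ⟶-unique {V} (⟶-cong {U} {V} U≈V (proj₂ (limit U))) (proj₂ (limit V))

    η-ε : η ε ≡ 0ℤ
    η-ε = ⟶-unique {ε} (proj₂ (limit ε)) ⟶-ε

    η-free : ∀ X → Free c A → η (X ∙ A) ≡ η X
    η-free {A} X free = ⟶-unique {X ∙ A} (proj₂ (limit (X ∙ A)))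
      (⟶-free {X} {A} free (proj₂ (limit X)))

    η-single : ∀ X → Single c B →
               η (X ∙ B) ≡ η X + (𝟙 (em {P = X ∙ B ≈ Z}) - 𝟙 (em {P = X ≈ Z}))
    η-single {B} X single = ⟶-unique {X ∙ B} (proj₂ (limit (X ∙ B)))
      (⟶-single {X} {B} single (proj₂ (limit X)))

-- Descending words along the cardinal.

module Counterexample (em : ∀ {a} → ExcludedMiddle a) {ℓ}
  {I : Set ℓ} (G : I → Group ℓ ℓ) (nontrivial : ∀ i → NonTrivial (G i))
  (κ : Cardinal ℓ) (regular : Regular κ) (uncountable : Uncountable κ)
  (embedding : Cardinal.Carrier κ ↣ I) where

  open Word
  open Restriction em G
  open Evaluation em G using (ρ≈values)
  open Paths em G
  open RegularUncountable em κ regular uncountable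
  open Cardinal κ using (_<_; isStrictTotalOrder) renaming (Carrier to K)
  open IsStrictTotalOrder isStrictTotalOrder
    using (compare) renaming (trans to <-trans; irrefl to <-irrefl)
  open Group (CompleteFreeProduct G)
    using (_≈_; _∙_; ε; _⁻¹; setoid; sym; trans; assoc; identityˡ; identityʳ; inverseʳ;
           ∙-congˡ; ∙-congʳ)
  open FiniteSums em setoid
  open SetoidMembership setoid using () renaming (_∈_ to _∈ʷ_)

  private
    module G i = Group (G i)
    variable
      U V W X Y : Word G

    open GroupProperties (CompleteFreeProduct G)
      using (//-rightDividesʳ; //-rightDividesˡ; \\-leftDividesʳ)

    cancelʳ : X ∙ W ≈ Y ∙ W → X ≈ Y
    cancelʳ {X} {W} {Y} e = trans (sym (//-rightDividesʳ W X))
      (trans (∙-congʳ e) (//-rightDividesʳ W Y))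

    cancelˡ : X ∙ V ≈ X ∙ W → V ≈ W
    cancelˡ {X} {V} {W} e = trans (sym (\\-leftDividesʳ X V))
      (trans (∙-congˡ {X ⁻¹} e) (\\-leftDividesʳ X W))

    transpose : X ∙ W ≈ Y → X ≈ Y ∙ W ⁻¹
    transpose {X} {W} e = trans (sym (//-rightDividesʳ W X)) (∙-congʳ e)

  ι : K → I
  ι = Injection.to embedding

  ι-injective : ∀ {α β} → ι α ≡ ι β → α ≡ β
  ι-injective = Injection.injective embedding

  g : K → Letter G
  g α = ι α , proj₁ (nontrivial (ι α))

  -- A non-trivial letter belongs to one factor only.
  g-index : ∀ {α i} → _∈G_ G (g α) i → ι α ≡ i
  g-index (_ , same _)       = refl
  g-index {α} (_ , unit e _) = contradiction e (proj₂ (nontrivial (ι α)))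

  descent : Word G
  descent = record
    { positions   = order
    ; letter      = g
    ; letter-cong = λ { refl → ≋-refl G }
    ; finite      = finite-at
    }
    where
    order = Flip.strictTotalOrder (record { isStrictTotalOrder = isStrictTotalOrder })

    finite-at : ∀ i → Finite order (λ α → _∈G_ G (g α) i)
    -- `ι` is injective, so at most one position carries a letter of `G i`.
    finite-at i with em {P = ∃[ α ] _∈G_ G (g α) i}
    ... | yes (α , m) = [ α , m ] ,
      λ (β , n) → here (ι-injective (≡.trans (g-index {β} n) (≡.sym (g-index {α} m))))
    ... | no none = [] , λ r → contradiction r none

  descent-free : ∀ {R : Pred K ℓ} {β} → ¬ R β → Free (ι β) (descent ∣ R)
  descent-free {R} ¬Rβ (α , r) m = ¬Rβ (≡.subst R (ι-injective (g-index {α} m)) r)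

  -- The order of `descent` is reversed, so the letter at `β` comes last in `Z β`: it is `B β`, and
  -- `Z⁺ β` is what precedes it.
  Z Z⁺ B : K → Word G
  Z  β = descent ∣ (λ α → β < α ⊎ β ≡ α)
  Z⁺ β = descent ∣ (β <_)
  B  β = descent ∣ (β ≡_)

  between : K → K → Word G
  between β γ = descent ∣ (λ α → (β < α ⊎ β ≡ α) × α < γ)

  B-single : ∀ β → Single (ι β) (B β)
  B-single β = (β , refl) , (λ { (_ , refl) → refl }) , _ , ≋-refl G , proj₂ (nontrivial (ι β))

  Z⁺-free : ∀ β → Free (ι β) (Z⁺ β)
  Z⁺-free β = descent-free (<-irrefl refl)

  Z-free : ∀ {β γ} → β < γ → Free (ι β) (Z γ)
  Z-free β<γ = descent-free λ { (inj₁ γ<β) → <-irrefl refl (<-trans β<γ γ<β)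
                              ; (inj₂ refl) → <-irrefl refl β<γ }

  between-free : ∀ β γ → Free (ι γ) (between β γ)
  between-free β γ = descent-free (<-irrefl refl ∘ proj₂)

  Z-head : ∀ β → Z β ≈ Z⁺ β ∙ B β
  Z-head β = ∣-split descent inj₁ inj₂ (λ r → r) λ { β<α refl → β<α }

  -- Larger indices come first, so `Z γ` is an initial segment of `Z β`; this is the common
  -- beginning that defines the germ.
  Z-tail : ∀ {β γ} → β < γ → Z β ≈ Z γ ∙ between β γ
  Z-tail {β} {γ} β<γ = ∣-split descent above-β proj₁ cut disjoint
    where
    above-β : ∀ {α} → γ < α ⊎ γ ≡ α → β < α ⊎ β ≡ α
    above-β (inj₁ γ<α) = inj₁ (<-trans β<γ γ<α)
    above-β (inj₂ refl) = inj₁ β<γ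
    cut : ∀ {α} → β < α ⊎ β ≡ α → (γ < α ⊎ γ ≡ α) ⊎ ((β < α ⊎ β ≡ α) × α < γ)
    cut {α} r with compare γ α
    ... | tri< γ<α _ _ = inj₁ (inj₁ γ<α)
    ... | tri≈ _ γ≡α _ = inj₁ (inj₂ γ≡α)
    ... | tri> _ _ α<γ = inj₂ (r , α<γ)
    disjoint : ∀ {α δ} → γ < α ⊎ γ ≡ α → (β < δ ⊎ β ≡ δ) × δ < γ → δ < α
    disjoint (inj₁ γ<α) (_ , δ<γ) = <-trans δ<γ γ<α
    disjoint (inj₂ refl) (_ , δ<γ) = δ<γ

  -- The indicators of the elements beyond `Z β`.

  ηᵏ : K → Word G → ℤ
  ηᵏ β = η (ι β) (Z β)

  private
    ηᵏ-cong : ∀ β {U V} → U ≈ V → ηᵏ β U ≡ ηᵏ β V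
    ηᵏ-cong β {U} {V} = η-cong (ι β) (Z β) {U} {V}

    ηᵏ-free : ∀ β {A} → Free (ι β) A → ηᵏ β A ≡ 0ℤ
    ηᵏ-free β {A} free = ≡.trans (ηᵏ-cong β {A} {ε ∙ A} (sym (identityˡ A)))
      (≡.trans (η-free (ι β) (Z β) {A} ε free) (η-ε (ι β) (Z β)))

    Z⁺≉Z : ∀ β → ¬ (Z⁺ β ≈ Z β)
    Z⁺≉Z β e = Single⇒≉ε {B = B β} (B-single β)
      (cancelˡ {Z⁺ β} (trans (sym (Z-head β)) (trans (sym e) (sym (identityʳ (Z⁺ β))))))

    -- The last letter is the only one of its factor in `Z β`, and reading it is an arrival at `Z β`
    -- that starts elsewhere, at `Z⁺ β`.
    ηᵏ-Z-self : ∀ β → ηᵏ β (Z β) ≡ 1ℤ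
    ηᵏ-Z-self β = ≡.trans (ηᵏ-cong β {Z β} {Z⁺ β ∙ B β} (Z-head β))
      (≡.trans (η-single (ι β) (Z β) {B β} (Z⁺ β) (B-single β))
        (cong₂ _+_ (ηᵏ-free β {Z⁺ β} (Z⁺-free β))
          (cong₂ _-_ (𝟙-true em (sym (Z-head β))) (𝟙-false em (Z⁺≉Z β)))))

    -- The way to `Z β` passes `Z γ`, and thereafter no letter of index `γ` occurs.
    ηᵏ-Z : ∀ {β γ} → β < γ → ∀ {X} → X ≈ Z β → ηᵏ γ X ≡ 1ℤ
    ηᵏ-Z {β} {γ} β<γ {X} e = ≡.trans
      (ηᵏ-cong γ {X} {Z γ ∙ between β γ} (trans e (Z-tail β<γ)))
      (≡.trans (η-free (ι γ) (Z γ) {between β γ} (Z γ) (between-free β γ)) (ηᵏ-Z-self γ))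

    -- Since ηᵏ β (Z β) is 1, arriving at Z β leads to the value 1 and
    -- departing from it leads to the value 0.
    data Step (β : K) (X Y : Word G) : Set ℓ where
      arrive : Y ≈ Z β → ηᵏ β Y ≡ 1ℤ → Step β X Y
      depart : X ≈ Z β → ηᵏ β X ≡ 1ℤ → ηᵏ β Y ≡ 0ℤ → Step β X Y
      stay   : ηᵏ β Y ≡ ηᵏ β X → Step β X Y

    ηᵏ-step : ∀ β {C} X → Single (ι β) C → Step β X (X ∙ C)
    ηᵏ-step β {C} X single = from em em (η-single (ι β) (Z β) {C} X single)
      where
      from : (XC≈Z? : Dec (X ∙ C ≈ Z β)) (X≈Z? : Dec (X ≈ Z β)) →
             ηᵏ β (X ∙ C) ≡ ηᵏ β X + (𝟙 XC≈Z? - 𝟙 X≈Z?) → Step β X (X ∙ C)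
      from (yes XC≈Z) _ _ = arrive XC≈Z (≡.trans (ηᵏ-cong β {X ∙ C} {Z β} XC≈Z) (ηᵏ-Z-self β))
      from (no _) (yes X≈Z) e =
        let ηX≡1 = ≡.trans (ηᵏ-cong β {X} {Z β} X≈Z) (ηᵏ-Z-self β)
        in depart X≈Z ηX≡1 (≡.trans e (cong (_+ (0ℤ - 1ℤ)) ηX≡1))
      from (no _) (no _) e = stay (≡.trans e (+-identityʳ _))

  -- Stretches free of the factor keep the value, and each outcome of `Step` yields 0, 1 or the old
  -- value.
  ηᵏ-01 : ∀ β W → ηᵏ β W ≡ 0ℤ ⊎ ηᵏ β W ≡ 1ℤ
  ηᵏ-01 β = path-induction [ ι β ] (λ W → ηᵏ β W ≡ 0ℤ ⊎ ηᵏ β W ≡ 1ℤ)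
    (λ {U} {V} U≈V → ≡.subst (λ n → n ≡ 0ℤ ⊎ n ≡ 1ℤ) (ηᵏ-cong β {U} {V} U≈V))
    (inj₁ (η-ε (ι β) (Z β)))
    (λ {X} {A} free → ≡.subst (λ n → n ≡ 0ℤ ⊎ n ≡ 1ℤ)
      (≡.sym (η-free (ι β) (Z β) {A} X (free (here refl)))))
    (λ { {X} {C} (here refl) single → after (ηᵏ-step β {C} X single) })
    where
    after : ∀ {X Y} → Step β X Y → ηᵏ β X ≡ 0ℤ ⊎ ηᵏ β X ≡ 1ℤ → ηᵏ β Y ≡ 0ℤ ⊎ ηᵏ β Y ≡ 1ℤ
    after (arrive _ e) _ = inj₂ e
    after (depart _ _ e) _ = inj₁ e
    after (stay e) = ≡.subst (λ n → n ≡ 0ℤ ⊎ n ≡ 1ℤ) (≡.sym e)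

  private
    0≢1 : 0ℤ ≢ 1ℤ
    0≢1 ()

  -- Along a path, `ηᵏ β` turns to 1 only on arrival at `Z β`, where `ηᵏ γ` is 1. Later `ηᵏ γ` could
  -- drop only on departure from `Z γ`, and there `ηᵏ β` is 0, since `Z γ` has no letter of index
  -- `β`.
  ηᵏ-mono : ∀ {β γ} → β < γ → ∀ W → ηᵏ β W ≡ 1ℤ → ηᵏ γ W ≡ 1ℤ
  ηᵏ-mono {β} {γ} β<γ = path-induction (ι β ∷ ι γ ∷ []) (λ W → ηᵏ β W ≡ 1ℤ → ηᵏ γ W ≡ 1ℤ)
    (λ {U} {V} U≈V mono e →
      ≡.trans (ηᵏ-cong γ {V} {U} (sym U≈V)) (mono (≡.trans (ηᵏ-cong β {U} {V} U≈V) e)))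
    (λ e → contradiction (≡.trans (≡.sym (η-ε (ι β) (Z β))) e) 0≢1)
    (λ {X} {A} free mono e → ≡.trans (η-free (ι γ) (Z γ) {A} X (free (there (here refl))))
      (mono (≡.trans (≡.sym (η-free (ι β) (Z β) {A} X (free (here refl)))) e)))
    (λ { {X} {C} (here refl) single → β-step {C = C} (ηᵏ-step β {C} X single) single
       ; {X} {C} (there (here refl)) single → γ-step {C = C} (ηᵏ-step γ {C} X single) single })
    where
    distinct : ι β ≢ ι γ
    distinct ιβ≡ιγ = <-irrefl (ι-injective ιβ≡ιγ) β<γ

    β-step : ∀ {X C} → Step β X (X ∙ C) → Single (ι β) C → (ηᵏ β X ≡ 1ℤ → ηᵏ γ X ≡ 1ℤ) →
             ηᵏ β (X ∙ C) ≡ 1ℤ → ηᵏ γ (X ∙ C) ≡ 1ℤ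
    β-step {X} {C} (arrive XC≈Z _) single mono e = ηᵏ-Z β<γ {X ∙ C} XC≈Z
    β-step (depart _ _ ≡0) single mono e = contradiction (≡.trans (≡.sym ≡0) e) 0≢1
    β-step {X} {C} (stay kept) single mono e = ≡.trans
      (η-free (ι γ) (Z γ) {C} X (Single⇒Free {B = C} distinct single))
      (mono (≡.trans (≡.sym kept) e))

    γ-step : ∀ {X C} → Step γ X (X ∙ C) → Single (ι γ) C → (ηᵏ β X ≡ 1ℤ → ηᵏ γ X ≡ 1ℤ) →
             ηᵏ β (X ∙ C) ≡ 1ℤ → ηᵏ γ (X ∙ C) ≡ 1ℤ
    γ-step {X} {C} step single mono e = from step
      (≡.trans (≡.sym (η-free (ι β) (Z β) {C} X
        (Single⇒Free {B = C} (distinct ∘ ≡.sym) single))) e)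
      where
      from : Step γ X (X ∙ C) → ηᵏ β X ≡ 1ℤ → ηᵏ γ (X ∙ C) ≡ 1ℤ
      from (arrive _ ≡1) _ = ≡1
      from (depart X≈Z _ _) ≡1 = contradiction
        (≡.trans (≡.sym (≡.trans (ηᵏ-cong β {X} {Z γ} X≈Z)
          (ηᵏ-free β {Z γ} (Z-free β<γ)))) ≡1) 0≢1
      from (stay kept) ≡1 = ≡.trans kept (mono ≡1)

  -- The germ `H` and its almost invariance.

  H : Pred (Word G) ℓ
  H W = ∃[ β ] ηᵏ β W ≡ 1ℤ

  η∞ : Word G → ℤ
  η∞ W = 𝟙 (em {P = H W})

  η∞-cong : U ≈ V → η∞ U ≡ η∞ V
  η∞-cong {U} {V} U≈V = 𝟙-cong
    (λ (β , e) → β , ≡.trans (ηᵏ-cong β {V} {U} (sym U≈V)) e)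
    (λ (β , e) → β , ≡.trans (ηᵏ-cong β {U} {V} U≈V) e) em em

  -- The values `ηᵏ γ W` are 0 or 1 and never fall as `γ` grows. If one is 1, so are all later ones;
  -- otherwise all are 0 and `point` is an arbitrary bound.
  settled : ∀ W → ∃[ β ] (∀ {γ} → β < γ → ηᵏ γ W ≡ η∞ W)
  settled W = from em
    where
    vanishes : ∀ {γ} → ¬ H W → ηᵏ γ W ≡ 0ℤ ⊎ ηᵏ γ W ≡ 1ℤ → ηᵏ γ W ≡ 0ℤ
    vanishes _ (inj₁ ≡0) = ≡0
    vanishes {γ} none (inj₂ ≡1) = contradiction (γ , ≡1) none

    from : (H? : Dec (H W)) → ∃[ β ] (∀ {γ} → β < γ → ηᵏ γ W ≡ 𝟙 H?)
    from (yes (β , e)) = β , λ β<γ → ηᵏ-mono β<γ W e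
    from (no none) = point , λ {γ} _ → vanishes none (ηᵏ-01 γ W)

  -- A change of `ηᵏ β` requires some letter of index `β` in `W` to be read at an arrival at or a
  -- departure from `Z β`. Each such letter allows two points, found by solving for `P`.
  crossing-points : ∀ β W → ∃[ Ps ] (∀ P → ηᵏ β (P ∙ W) ≢ ηᵏ β P → P ∈ʷ Ps)
  crossing-points β = path-induction [ ι β ]
    (λ W → ∃[ Ps ] (∀ P → ηᵏ β (P ∙ W) ≢ ηᵏ β P → P ∈ʷ Ps))
    (λ {U} {V} U≈V (Ps , ∈Ps) → Ps , λ P moved → ∈Ps P
      λ e → moved (≡.trans (ηᵏ-cong β {P ∙ V} {P ∙ U} (∙-congˡ {P} (sym U≈V))) e))
    ([] , λ P moved → contradiction (ηᵏ-cong β {P ∙ ε} {P} (identityʳ P)) moved)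
    (λ {X} {A} free (Ps , ∈Ps) → Ps , λ P moved → ∈Ps P
      λ e → moved (≡.trans (ηᵏ-cong β {P ∙ (X ∙ A)} {P ∙ X ∙ A} (sym (assoc P X A)))
        (≡.trans (η-free (ι β) (Z β) {A} (P ∙ X) (free (here refl))) e)))
    (λ { {X} {C} (here refl) single (Ps , ∈Ps) →
         Z β ∙ (X ∙ C) ⁻¹ ∷ Z β ∙ X ⁻¹ ∷ Ps ,
         λ P moved → after {C = C} ∈Ps P moved (ηᵏ-step β {C} (P ∙ X) single) })
    where
    after : ∀ {X C Ps} → (∀ P → ηᵏ β (P ∙ X) ≢ ηᵏ β P → P ∈ʷ Ps) →
            ∀ P → ηᵏ β (P ∙ (X ∙ C)) ≢ ηᵏ β P → Step β (P ∙ X) (P ∙ X ∙ C) →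
            P ∈ʷ (Z β ∙ (X ∙ C) ⁻¹ ∷ Z β ∙ X ⁻¹ ∷ Ps)
    after {X} {C} ∈Ps P moved (arrive e _) =
      here (transpose {P} {X ∙ C} (trans (sym (assoc P X C)) e))
    after {X} {C} ∈Ps P moved (depart e _ _) = there (here (transpose {P} {X} e))
    after {X} {C} ∈Ps P moved (stay kept) = there (there (∈Ps P λ e → moved
      (≡.trans (ηᵏ-cong β {P ∙ (X ∙ C)} {P ∙ X ∙ C} (sym (assoc P X C))) (≡.trans kept e))))

  -- 1 where right translation by `W` enters `H`, -1 where it leaves `H`, 0 elsewhere.
  δ : Word G → Word G → ℤ
  δ W P = η∞ (P ∙ W) - η∞ P

  δ-cong : ∀ W → δ W Preserves _≈_ ⟶ _≡_
  δ-cong W {P} {Q} P≈Q = cong₂ _-_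
    (η∞-cong {P ∙ W} {Q ∙ W} (∙-congʳ {W} P≈Q)) (η∞-cong {P} {Q} P≈Q)

  abstract
    -- Countably many points settle simultaneously at some β < κ.
    support : ∀ W → ∃[ Ps ] δ W SupportedBy Ps
    support W = finitely-many (λ P → δ W P ≢ 0ℤ) bounded
      where
      bounded : (s : ℕ → Word G) → (∀ n → δ W (s n) ≢ 0ℤ) → ∃[ Ps ] (∀ n → s n ∈ʷ Ps)
      bounded s ≢0 =
        let before = λ n → upper-bound (proj₁ (settled (s n))) (proj₁ (settled (s n ∙ W)))
            γ , <γ = countable-sup (proj₁ ∘ before)
            Ps , ∈Ps = crossing-points γ W
        in Ps , λ n → ∈Ps (s n) λ e →
          let _ , l , r = before n in
          ≢0 n (≡.trans
            (cong₂ _-_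
              (≡.trans (≡.sym (proj₂ (settled (s n ∙ W)) (<-trans r (<γ n)))) e)
              (≡.sym (proj₂ (settled (s n)) (<-trans l (<γ n)))))
            (+-inverseʳ (ηᵏ γ (s n))))

  -- Summation to a homomorphism.

  φ : Word G → ℤ
  φ W = ∑ (δ W) (proj₁ (support W))

  φ-unique : ∀ W {Ps} → δ W SupportedBy Ps → φ W ≡ ∑ (δ W) Ps
  φ-unique W = ∑-unique (λ {P} {Q} → δ-cong W {P} {Q}) (proj₂ (support W))

  φ-cong : U ≈ V → φ U ≡ φ V
  φ-cong {U} {V} U≈V = ≡.trans (∑-cong δ≗ (proj₁ (support U)))
    (≡.sym (φ-unique V λ P ≢0 → proj₂ (support U) P (≢0 ∘ ≡.trans (≡.sym (δ≗ P)))))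
    where
    δ≗ : ∀ P → δ U P ≡ δ V P
    δ≗ P = cong (_- η∞ P) (η∞-cong {P ∙ U} {P ∙ V} (∙-congˡ {P} U≈V))

  -- P ↦ δ V (P ∙ U) is a translate of δ V, so it has the same sum.
  φ-homo : ∀ U V → φ (U ∙ V) ≡ φ U + φ V
  φ-homo U V = begin
    φ (U ∙ V)
      ≡⟨ φ-unique (U ∙ V) {Ps} UV-supp ⟩
    ∑ (δ (U ∙ V)) Ps
      ≡⟨ ∑-cong cocycle Ps ⟩
    ∑ (λ P → δ U P + δ V (P ∙ U)) Ps
      ≡⟨ ∑-+ (δ U) (λ P → δ V (P ∙ U)) Ps ⟩
    ∑ (δ U) Ps + ∑ (λ P → δ V (P ∙ U)) Ps
      ≡⟨ cong₂ _+_ (≡.sym (φ-unique U {Ps} U-supp)) translated ⟩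
    φ U + φ V
      ∎
    where
    open ≡-Reasoning
    back : Word G → Word G
    back P = P ∙ U ⁻¹

    translates = map back (proj₁ (support V))
    -- Supports `δ U` and the translate of `δ V`, hence also their sum `δ (U ∙ V)`.
    Ps = proj₁ (support U) ++ translates

    cocycle : ∀ P → δ (U ∙ V) P ≡ δ U P + δ V (P ∙ U)
    cocycle P = ≡.trans
      (cong (_- η∞ P) (η∞-cong {P ∙ (U ∙ V)} {P ∙ U ∙ V} (sym (assoc P U V))))
      (telescope (η∞ P) (η∞ (P ∙ U)) (η∞ (P ∙ U ∙ V)))
      where
      telescope : ∀ l m n → n - l ≡ m - l + (n - m)
      telescope = solve-∀

    U-supp : δ U SupportedBy Ps
    U-supp P ≢0 = Any.++⁺ˡ (proj₂ (support U) P ≢0)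

    V-supp : (λ P → δ V (P ∙ U)) SupportedBy translates
    V-supp P ≢0 = Any.map⁺
      (Any.map (λ {Q} e → transpose {P} {U} {Q} e) (proj₂ (support V) (P ∙ U) ≢0))

    UV-supp : δ (U ∙ V) SupportedBy Ps
    UV-supp P ≢0 = from em em
      where
      from : Dec (δ U P ≡ 0ℤ) → Dec (δ V (P ∙ U) ≡ 0ℤ) → P ∈ʷ Ps
      from (no ≢0′) _      = U-supp P ≢0′
      from (yes _) (no ≢0′) = Any.++⁺ʳ (proj₁ (support U)) (V-supp P ≢0′)
      from (yes e) (yes f)  = contradiction (≡.trans (cocycle P) (cong₂ _+_ e f)) ≢0

    translated : ∑ (λ P → δ V (P ∙ U)) Ps ≡ φ V
    translated = begin
      ∑ (λ P → δ V (P ∙ U)) Ps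
        ≡⟨ ∑-unique {f = λ P → δ V (P ∙ U)} {Ps} {translates}
             (λ {P} {Q} e → δ-cong V {P ∙ U} {Q ∙ U} (∙-congʳ {U} e))
             (λ P ≢0 → Any.++⁺ʳ (proj₁ (support U)) (V-supp P ≢0)) V-supp ⟩
      ∑ (λ P → δ V (P ∙ U)) translates
        ≡⟨ ∑-map back (λ e → ∙-congʳ {U ⁻¹} e) (λ {P} {Q} → cancelʳ {P} {U ⁻¹} {Q})
             (λ P → δ V (P ∙ U)) (proj₁ (support V)) ⟩
      ∑ (λ P → δ V (back P ∙ U)) (proj₁ (support V))
        ≡⟨ ∑-cong (λ P → δ-cong V {back P ∙ U} {P} (//-rightDividesˡ U P)) (proj₁ (support V)) ⟩
      φ V ∎

  isHomomorphism : IsHomomorphismToℤ (CompleteFreeProduct G) φ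
  isHomomorphism = record
    { isMonoidHomomorphism = record
      { isMagmaHomomorphism = record
        { isRelHomomorphism = record { cong = λ {U} {V} → φ-cong {U} {V} }
        ; homo = φ-homo
        }
      ; ε-homo = φ-ε
      }
    ; ⁻¹-homo = λ W → opposite (φ W) (φ (W ⁻¹))
        (≡.trans (≡.sym (φ-homo W (W ⁻¹)))
          (≡.trans (φ-cong {W ∙ W ⁻¹} {ε} (inverseʳ W)) φ-ε))
    }
    where
    idempotent : ∀ m n → n + m - m ≡ n
    idempotent = solve-∀
    φ-ε : φ ε ≡ 0ℤ
    φ-ε = ≡.trans (≡.sym (idempotent (φ ε) (φ ε)))
      (≡.trans (cong (_- φ ε) (≡.trans (≡.sym (φ-homo ε ε)) (φ-cong {ε ∙ ε} {ε} (identityˡ ε))))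
        (+-inverseʳ (φ ε)))
    opposite : ∀ m n → m + n ≡ 0ℤ → n ≡ - m
    opposite m n e = ≡.trans (rearrange m n) (≡.trans (cong (_- m) e) (+-identityˡ (- m)))
      where
      rearrange : ∀ m n → n ≡ m + n - m
      rearrange = solve-∀

  -- Reading Z β from P arrives at Z γ by its letter at γ only if P is
  -- trivial, and departs from Z γ only if P ∙ Z β lies in H nevertheless,
  -- which cannot happen once γ is past the point where P ∙ Z β settles.
  private module Reading {β γ} (β<γ : β < γ) (P : Word G) where

    regroup : P ∙ Z β ≈ P ∙ Z⁺ γ ∙ B γ ∙ between β γ
    regroup = begin
      P ∙ Z β                            ≈⟨ ∙-congˡ {P} (Z-tail β<γ) ⟩
      P ∙ (Z γ ∙ between β γ)            ≈⟨ assoc P (Z γ) (between β γ) ⟨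
      P ∙ Z γ ∙ between β γ              ≈⟨ ∙-congʳ {between β γ} (∙-congˡ {P} (Z-head γ)) ⟩
      P ∙ (Z⁺ γ ∙ B γ) ∙ between β γ     ≈⟨ ∙-congʳ {between β γ} (assoc P (Z⁺ γ) (B γ)) ⟨
      P ∙ Z⁺ γ ∙ B γ ∙ between β γ       ∎
      where open SetoidReasoning setoid

    -- The letters of `between β γ` have indices below `γ`.
    drop-between : ∀ {ζ} → γ < ζ ⊎ γ ≡ ζ → ηᵏ ζ (P ∙ Z β) ≡ ηᵏ ζ (P ∙ Z⁺ γ ∙ B γ)
    drop-between {ζ} γ≤ζ = ≡.trans
      (ηᵏ-cong ζ {P ∙ Z β} {P ∙ Z⁺ γ ∙ B γ ∙ between β γ} regroup)
      (η-free (ι ζ) (Z ζ) {between β γ} (P ∙ Z⁺ γ ∙ B γ)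
        (descent-free λ { (_ , ζ<γ) → [ (λ γ<ζ → <-irrefl refl (<-trans γ<ζ ζ<γ))
                                       , (λ { refl → <-irrefl refl ζ<γ }) ]′ γ≤ζ }))

    δ-step : Step γ (P ∙ Z⁺ γ) (P ∙ Z⁺ γ ∙ B γ) → ¬ (P ≈ ε) →
             ηᵏ γ P ≡ η∞ P → ηᵏ γ (P ∙ Z β) ≡ η∞ (P ∙ Z β) → δ (Z β) P ≡ 0ℤ
    δ-step (arrive e _) P≉ε _ _ = contradiction
      (cancelʳ {P} {Z γ} {ε} (begin
        P ∙ Z γ            ≈⟨ ∙-congˡ {P} (Z-head γ) ⟩
        P ∙ (Z⁺ γ ∙ B γ)   ≈⟨ assoc P (Z⁺ γ) (B γ) ⟨
        P ∙ Z⁺ γ ∙ B γ     ≈⟨ e ⟩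
        Z γ                ≈⟨ identityˡ (Z γ) ⟨
        ε ∙ Z γ            ∎)) P≉ε
      where open SetoidReasoning setoid
    δ-step (stay kept) _ P-settled PZ-settled = ≡.trans
      (cong₂ _-_
        (≡.trans (≡.sym PZ-settled) (≡.trans (drop-between (inj₂ refl))
          (≡.trans kept (η-free (ι γ) (Z γ) {Z⁺ γ} P (Z⁺-free γ)))))
        (≡.sym P-settled))
      (+-inverseʳ (ηᵏ γ P))
    δ-step (depart e _ ≡0) _ _ PZ-settled = contradiction
      (≡.trans (≡.sym ≡0) (≡.trans (≡.sym (drop-between (inj₂ refl)))
        (≡.trans PZ-settled (𝟙-true em (γ′ , η≡1))))) 0≢1
      where
      -- `P ∙ Z⁺ γ` equals `Z γ`, hence lies beyond `Z γ′`; the letters of `Z β` from `γ` on have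
      -- indices below `γ′` and cannot change that. So `P ∙ Z β` lies in `H`.
      γ′ = proj₁ (above γ)
      γ<γ′ = proj₂ (above γ)
      η≡1 : ηᵏ γ′ (P ∙ Z β) ≡ 1ℤ
      η≡1 = ≡.trans (drop-between (inj₁ γ<γ′))
        (≡.trans (η-free (ι γ′) (Z γ′) {B γ} (P ∙ Z⁺ γ)
            (Single⇒Free {B = B γ} (λ e → <-irrefl (ι-injective e) γ<γ′) (B-single γ)))
          (ηᵏ-Z γ<γ′ {P ∙ Z⁺ γ} e))

  -- `Reading` leaves only `P = ε`: the identity is outside `H` and `Z β` inside, so the sum is 1.
  φ-Z : ∀ β → φ (Z β) ≡ 1ℤ
  φ-Z β = ≡.trans (φ-unique (Z β) {ε ∷ []} supp)
    (≡.trans (∑-singleton (δ (Z β)) ε)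
      (≡.trans (cong (_- η∞ ε) η∞-εZ) (cong (λ n → 1ℤ - n) η∞-ε)))
    where
    η∞-ε : η∞ ε ≡ 0ℤ
    η∞-ε = 𝟙-false em λ (γ , e) → contradiction (≡.trans (≡.sym (η-ε (ι γ) (Z γ))) e) 0≢1

    η∞-εZ : η∞ (ε ∙ Z β) ≡ 1ℤ
    η∞-εZ = ≡.trans (η∞-cong {ε ∙ Z β} {Z β} (identityˡ (Z β))) (𝟙-true em (β , ηᵏ-Z-self β))

    supp : δ (Z β) SupportedBy (ε ∷ [])
    supp P ≢0 = from em
      where
      from : Dec (P ≈ ε) → P ∈ʷ (ε ∷ [])
      from (yes P≈ε) = here P≈ε
      from (no P≉ε) =
        -- `γ` exceeds `β` and the indices past which `P` and `P ∙ Z β` are settled.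
        let γ₀ , P<γ₀ , PZ<γ₀ = upper-bound (proj₁ (settled P)) (proj₁ (settled (P ∙ Z β)))
            γ , β<γ , γ₀<γ = upper-bound β γ₀
        in contradiction
          (Reading.δ-step β<γ P (ηᵏ-step γ {B γ} (P ∙ Z⁺ γ) (B-single γ)) P≉ε
            (proj₂ (settled P) (<-trans P<γ₀ γ₀<γ))
            (proj₂ (settled (P ∙ Z β)) (<-trans PZ<γ₀ γ₀<γ))) ≢0

  -- Failure of factorization through finitely many factors.

  avoiding : ∀ F → ∃[ β ] (∀ α → ι α ∈ F → α < β)
  avoiding [] = point , λ _ ()
  avoiding (i ∷ F) with avoiding F | em {P = ∃[ α ] ι α ≡ i}
  ... | β , <β | no none = β , λ { α (here eq) → contradiction (α , eq) none
                                 ; α (there α∈) → <β α α∈ }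
  ... | β , <β | yes (α₀ , refl) =
    let γ , β<γ , α₀<γ = upper-bound β α₀
    in γ , λ { α (here eq) → ≡.subst (_< γ) (≡.sym (ι-injective eq)) α₀<γ
             ; α (there α∈) → <-trans (<β α α∈) β<γ }

  -- Past all indices of the factors in `F`, the word `Z β` has trivial image under `ρ G F`, so a
  -- factored map sends it to 0 instead of 1.
  no-factorization : ∀ F (h : List (Generator G (_∈ F)) → ℤ) →
    IsHomomorphismToℤ (FreeProduct G (_∈ F)) h → ¬ (∀ W → φ W ≡ h (ρ G F W))
  no-factorization F h h-homo φ≗h = 0≢1 (≡.sym (≡.trans (≡.sym (φ-Z β))
    (≡.trans (φ≗h (Z β)) (≡.trans (IsGroupHomomorphism.⟦⟧-cong h-homo ρ≈[])
      (IsGroupHomomorphism.ε-homo h-homo)))))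
    where
    β = proj₁ (avoiding F)
    absent : ∀ {α} → β < α ⊎ β ≡ α → ¬ (ι α ∈ F)
    absent {α} (inj₁ β<α) α∈ = <-irrefl refl (<-trans β<α (proj₂ (avoiding F) α α∈))
    absent {α} (inj₂ refl) α∈ = <-irrefl refl (proj₂ (avoiding F) α α∈)
    ρ≈[] : _≈*_ G (_∈ F) (ρ G F (Z β)) []
    ρ≈[] = ρ≈values (Z β) F [] λ (α , r) (i , i∈F , m) →
      contradiction (≡.subst (_∈ F) (≡.sym (g-index {α} m)) i∈F) (absent r)

theorem2p4 :
  (∀ {a} → ExcludedMiddle a) →
  (∀ {a₁ a₂ b₁ b₂ r} → AxiomOfChoice a₁ a₂ b₁ b₂ r) →
  ∀ {ℓ} (Λ : Cardinal ℓ) → Uncountable Λ →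
  (G : Cardinal.Carrier Λ → Group ℓ ℓ) → (∀ α → NonTrivial (G α)) →
  (κ : Cardinal ℓ) → Regular κ → Uncountable κ → κ ≤ᶜ Λ →
  Σ[ φ ∈ (Word G → ℤ) ]
    IsHomomorphismToℤ (CompleteFreeProduct G) φ ×
    ¬ (Σ[ F ∈ List (Cardinal.Carrier Λ) ]
       Σ[ h ∈ (Group.Carrier (FreeProduct G (_∈ F)) → ℤ) ]
         IsHomomorphismToℤ (FreeProduct G (_∈ F)) h ×
         (∀ W → φ W ≡ h (ρ G F W)))
theorem2p4 em _ Λ _ G nontrivial κ regular uncountable κ≤Λ =
  φ , isHomomorphism , λ (F , h , h-homo , φ≗h) → no-factorization F h h-homo φ≗h
  where open Counterexample em G nontrivial κ regular uncountable κ≤Λ
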